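{- Let $f:\mathbb{Z}^{+}\to\mathbb{R}^{+}$ and let $n$ be a positive integer with $f(n)\le \frac{n}{1000}$. If $G$ is a graph with $n$ vertices and exactly $\frac{n^2}{4}-nf(n)$ edges in which every edge is contained in at least one triangle, then either $bk(G)>\frac{n}{1000}$ or $f(n)\,(f(n)+bk(G))\,bk(G)\ge \frac{n^2}{1250}$.
   Context: Graphs are finite and simple. A book of size $q$ in a graph is a set of $q$ triangles sharing a common edge. $bk(G)$ denotes the size of the largest book in $G$, i.e. the maximum over edges $e$ of $G$ of the number of triangles of $G$ containing $e$. -}

module Defs where

open import Level using (0ℓ)
open import Data.Fin as Fin using (Fin)
import Data.Fin.Properties as Fin
open import Data.Integer using (+_)
open import Data.List using (List; []; _∷_; allFin; cartesianProduct; filter; length; map)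
open import Data.List.Extrema.Nat using (max)
open import Data.List.Membership.Propositional using (_∈_)
import Data.List.Membership.DecPropositional as DecMembership
open import Data.Nat as ℕ using (ℕ)
import Data.Nat.Properties as ℕ
open import Data.Product using (∃; ∃-syntax; _×_; _,_; proj₁; proj₂)
open import Data.Rational
open import Data.Rational.Properties
open import Data.Rational.Solver using (module +-*-Solver)
open import Relation.Binary using (Rel; Decidable; Symmetric; Irreflexive)
open import Relation.Binary.PropositionalEquality
open import Relation.Nullary using (Dec; _×-dec_)

------------------------------------------------------------------------
-- Real numbers: Cauchy sequences of rationals carrying a modulus of
-- convergence, compared with the equivalence _≈ℝ_ rather than with _≡_.

IsCauchy : (ℕ → ℚ) → Set
IsCauchy x = ∀ ε → 0ℚ < ε →
  ∃[ N ] (∀ i j → N ℕ.≤ i → N ℕ.≤ j → ∣ x i - x j ∣ < ε)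

record ℝ : Set where
  constructor mkℝ
  field
    seq    : ℕ → ℚ
    cauchy : IsCauchy seq

open ℝ public

infix  4 _≈ℝ_ _≤ℝ_ _<ℝ_ _≥ℝ_ _>ℝ_
infixl 6 _+ℝ_ _-ℝ_
infixl 7 _*ℝ_
infix  8 -ℝ_

_≈ℝ_ : Rel ℝ 0ℓ
x ≈ℝ y = ∀ ε → 0ℚ < ε → ∃[ N ] (∀ i → N ℕ.≤ i → ∣ seq x i - seq y i ∣ < ε)

_≤ℝ_ : Rel ℝ 0ℓ
x ≤ℝ y = ∀ ε → 0ℚ < ε → ∃[ N ] (∀ i → N ℕ.≤ i → seq x i < seq y i + ε)

-- The gap ε must be uniform in i: termwise < does not survive in the limit.
_<ℝ_ : Rel ℝ 0ℓ
x <ℝ y = ∃[ ε ] (0ℚ < ε × ∃[ N ] (∀ i → N ℕ.≤ i → seq x i + ε < seq y i))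

_≥ℝ_ : Rel ℝ 0ℓ
x ≥ℝ y = y ≤ℝ x

_>ℝ_ : Rel ℝ 0ℓ
x >ℝ y = y <ℝ x

fromℚ : ℚ → ℝ
fromℚ q = mkℝ (λ _ → q) λ ε 0<ε → 0 , λ _ _ _ _ →
  subst (_< ε) (sym (cong ∣_∣ (+-inverseʳ q))) 0<ε

fromℕ : ℕ → ℝ
fromℕ k = fromℚ (+ k / 1)

0ℝ : ℝ
0ℝ = fromℚ 0ℚ

half-pos : ∀ {ε} → 0ℚ < ε → 0ℚ < ½ * ε
half-pos {ε} 0<ε = positive⁻¹ (½ * ε) {{pos*pos⇒pos ½ ε {{positive 0<ε}}}}

half+half : ∀ ε → ½ * ε + ½ * ε ≡ ε
half+half ε = trans (sym (*-distribʳ-+ ε ½ ½)) (*-identityˡ ε)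

+-cauchy : ∀ x y → IsCauchy x → IsCauchy y → IsCauchy (λ i → x i + y i)
+-cauchy x y cx cy ε 0<ε with cx (½ * ε) (half-pos 0<ε) | cy (½ * ε) (half-pos 0<ε)
... | M , p | N , q = M ℕ.⊔ N , λ i j Ki Kj → begin-strict
  ∣ x i + y i - (x j + y j) ∣       ≡⟨ cong ∣_∣ (rearrange (x i) (y i) (x j) (y j)) ⟩
  ∣ (x i - x j) + (y i - y j) ∣     ≤⟨ ∣p+q∣≤∣p∣+∣q∣ (x i - x j) (y i - y j) ⟩
  ∣ x i - x j ∣ + ∣ y i - y j ∣     <⟨ +-mono-< (p i j (ℕ.m⊔n≤o⇒m≤o M N Ki) (ℕ.m⊔n≤o⇒m≤o M N Kj))
                                               (q i j (ℕ.m⊔n≤o⇒n≤o M N Ki) (ℕ.m⊔n≤o⇒n≤o M N Kj)) ⟩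
  ½ * ε + ½ * ε                     ≡⟨ half+half ε ⟩
  ε                                 ∎
  where
  open ≤-Reasoning
  rearrange : ∀ a b c d → a + b - (c + d) ≡ (a - c) + (b - d)
  rearrange = solve 4 (λ a b c d → a :+ b :- (c :+ d) := (a :- c) :+ (b :- d)) refl
    where open +-*-Solver

neg-cauchy : ∀ x → IsCauchy x → IsCauchy (λ i → - x i)
neg-cauchy x cx ε 0<ε with cx ε 0<ε
... | N , p = N , λ i j Ni Nj →
  subst (_< ε) (trans (sym (∣-p∣≡∣p∣ (x i - x j)))
                      (cong ∣_∣ (neg-distrib-+ (x i) (- x j))))
               (p i j Ni Nj)

eventuallyBounded : ∀ x → IsCauchy x →
  ∃[ B ] (Positive B × ∃[ N ] (∀ i → N ℕ.≤ i → ∣ x i ∣ ≤ B))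
eventuallyBounded x cx with cx 1ℚ (positive⁻¹ 1ℚ)
... | N , p = 1ℚ + ∣ x N ∣ , pos+nonNeg⇒pos 1ℚ ∣ x N ∣ {{∣-∣-nonNeg (x N)}} , N , λ i Ni → begin
  ∣ x i ∣                      ≡⟨ cong ∣_∣ (split (x i) (x N)) ⟩
  ∣ (x i - x N) + x N ∣        ≤⟨ ∣p+q∣≤∣p∣+∣q∣ (x i - x N) (x N) ⟩
  ∣ x i - x N ∣ + ∣ x N ∣      ≤⟨ +-monoˡ-≤ ∣ x N ∣ (<⇒≤ (p i N Ni ℕ.≤-refl)) ⟩
  1ℚ + ∣ x N ∣                 ∎
  where
  open ≤-Reasoning
  split : ∀ a b → a ≡ (a - b) + b
  split = solve 2 (λ a b → a := (a :- b) :+ b) refl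
    where open +-*-Solver

scaledCauchy : ∀ x → IsCauchy x → ∀ B → Positive B → ∀ ε → 0ℚ < ε →
  ∃[ N ] (∀ i j → N ℕ.≤ i → N ℕ.≤ j → ∀ a → ∣ a ∣ ≤ B → ∣ a * (x i - x j) ∣ < ε)
scaledCauchy x cx B B>0 ε 0<ε = proj₁ c , λ i j Ni Nj a a≤B → begin-strict
  ∣ a * (x i - x j) ∣          ≡⟨ ∣p*q∣≡∣p∣*∣q∣ a (x i - x j) ⟩
  ∣ a ∣ * ∣ x i - x j ∣        ≤⟨ *-monoʳ-≤-nonNeg ∣ x i - x j ∣ {{∣-∣-nonNeg (x i - x j)}} a≤B ⟩
  B * ∣ x i - x j ∣            <⟨ *-monoʳ-<-pos B (proj₂ c i j Ni Nj) ⟩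
  B * (1/ B * ε)               ≡⟨ sym (*-assoc B (1/ B) ε) ⟩
  B * 1/ B * ε                 ≡⟨ cong (_* ε) (*-inverseʳ B) ⟩
  1ℚ * ε                       ≡⟨ *-identityˡ ε ⟩
  ε                            ∎
  where
  open ≤-Reasoning
  instance
    B-pos : Positive B
    B-pos = B>0
    B-nonZero : NonZero B
    B-nonZero = pos⇒nonZero B
  c = cx (1/ B * ε)
         (positive⁻¹ (1/ B * ε) {{pos*pos⇒pos (1/ B) {{1/pos⇒pos B}} ε {{positive 0<ε}}}})

*-cauchy : ∀ x y → IsCauchy x → IsCauchy y → IsCauchy (λ i → x i * y i)
*-cauchy x y cx cy ε 0<ε =
  let A , A>0 , L , boundx = eventuallyBounded x cx
      B , B>0 , M , boundy = eventuallyBounded y cy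
      P , p = scaledCauchy y cy A A>0 (½ * ε) (half-pos 0<ε)
      Q , q = scaledCauchy x cx B B>0 (½ * ε) (half-pos 0<ε)
  in (L ℕ.⊔ M) ℕ.⊔ (P ℕ.⊔ Q) , λ i j Ki Kj →
  combine (p i j (≥P L M P Q Ki) (≥P L M P Q Kj) (x i) (boundx i (≥L L M P Q Ki)))
          (q i j (≥Q L M P Q Ki) (≥Q L M P Q Kj) (y j) (boundy j (≥M L M P Q Kj)))
  where
  open ≤-Reasoning
  rearrange : ∀ a b c d → a * b - c * d ≡ a * (b - d) + d * (a - c)
  rearrange = solve 4 (λ a b c d → a :* b :- c :* d := a :* (b :- d) :+ d :* (a :- c)) refl
    where open +-*-Solver
  combine : ∀ {i j} → ∣ x i * (y i - y j) ∣ < ½ * ε → ∣ y j * (x i - x j) ∣ < ½ * ε →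
            ∣ x i * y i - x j * y j ∣ < ε
  combine {i} {j} p q = begin-strict
    ∣ x i * y i - x j * y j ∣
      ≡⟨ cong ∣_∣ (rearrange (x i) (y i) (x j) (y j)) ⟩
    ∣ x i * (y i - y j) + y j * (x i - x j) ∣
      ≤⟨ ∣p+q∣≤∣p∣+∣q∣ (x i * (y i - y j)) (y j * (x i - x j)) ⟩
    ∣ x i * (y i - y j) ∣ + ∣ y j * (x i - x j) ∣
      <⟨ +-mono-< p q ⟩
    ½ * ε + ½ * ε
      ≡⟨ half+half ε ⟩
    ε ∎
  module _ (L M P Q : ℕ) {i : ℕ} (K : (L ℕ.⊔ M) ℕ.⊔ (P ℕ.⊔ Q) ℕ.≤ i) where
    ≥L : L ℕ.≤ i
    ≥L = ℕ.m⊔n≤o⇒m≤o L M (ℕ.m⊔n≤o⇒m≤o (L ℕ.⊔ M) (P ℕ.⊔ Q) K)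
    ≥M : M ℕ.≤ i
    ≥M = ℕ.m⊔n≤o⇒n≤o L M (ℕ.m⊔n≤o⇒m≤o (L ℕ.⊔ M) (P ℕ.⊔ Q) K)
    ≥P : P ℕ.≤ i
    ≥P = ℕ.m⊔n≤o⇒m≤o P Q (ℕ.m⊔n≤o⇒n≤o (L ℕ.⊔ M) (P ℕ.⊔ Q) K)
    ≥Q : Q ℕ.≤ i
    ≥Q = ℕ.m⊔n≤o⇒n≤o P Q (ℕ.m⊔n≤o⇒n≤o (L ℕ.⊔ M) (P ℕ.⊔ Q) K)

_+ℝ_ : ℝ → ℝ → ℝ
x +ℝ y = mkℝ (λ i → seq x i + seq y i) (+-cauchy (seq x) (seq y) (cauchy x) (cauchy y))

-ℝ_ : ℝ → ℝ
-ℝ x = mkℝ (λ i → - seq x i) (neg-cauchy (seq x) (cauchy x))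

_-ℝ_ : ℝ → ℝ → ℝ
x -ℝ y = x +ℝ (-ℝ y)

_*ℝ_ : ℝ → ℝ → ℝ
x *ℝ y = mkℝ (λ i → seq x i * seq y i) (*-cauchy (seq x) (seq y) (cauchy x) (cauchy y))

------------------------------------------------------------------------
-- Finite simple graphs

record Graph (n : ℕ) : Set₁ where
  field
    _~_    : Rel (Fin n) 0ℓ
    _~?_   : Decidable _~_
    sym~   : Symmetric _~_
    irrefl : Irreflexive _≡_ _~_

module _ {n : ℕ} where

  open DecMembership (Fin._≟_ {n}) using (_∈?_)

  -- Edges and triangles are unordered; each is represented once, by its
  -- vertices in increasing order.
  Pair : Set
  Pair = Fin n × Fin n

  Triple : Set
  Triple = Fin n × Fin n × Fin n

  _⊂_ : Pair → Triple → Set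
  (u , v) ⊂ (a , b , c) = u ∈ (a ∷ b ∷ c ∷ []) × v ∈ (a ∷ b ∷ c ∷ [])

  _⊂?_ : Decidable _⊂_
  (u , v) ⊂? (a , b , c) = u ∈? (a ∷ b ∷ c ∷ []) ×-dec v ∈? (a ∷ b ∷ c ∷ [])

  module _ (G : Graph n) where

    open Graph G

    IsEdge : Pair → Set
    IsEdge (u , v) = u Fin.< v × u ~ v

    isEdge? : ∀ e → Dec (IsEdge e)
    isEdge? (u , v) = u Fin.<? v ×-dec u ~? v

    IsTriangle : Triple → Set
    IsTriangle (a , b , c) = IsEdge (a , b) × IsEdge (b , c) × IsEdge (a , c)

    isTriangle? : ∀ t → Dec (IsTriangle t)
    isTriangle? (a , b , c) = isEdge? (a , b) ×-dec isEdge? (b , c) ×-dec isEdge? (a , c)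

    edges : List Pair
    edges = filter isEdge? (cartesianProduct (allFin n) (allFin n))

    triangles : List Triple
    triangles = filter isTriangle?
      (cartesianProduct (allFin n) (cartesianProduct (allFin n) (allFin n)))

    ∣E∣ : ℕ
    ∣E∣ = length edges

    trianglesContaining : Pair → List Triple
    trianglesContaining e = filter (e ⊂?_) triangles

    -- Equal to 0 when G has no edges.
    bk : ℕ
    bk = max 0 (map (λ e → length (trianglesContaining e)) edges)

    EveryEdgeInTriangle : Set
    EveryEdgeInTriangle = ∀ e → IsEdge e → ∃[ t ] (IsTriangle t × e ⊂ t)

module Submission where

-- Write b = bk G, e = |E| and D = n² − 4e, so that f(n) = D/4n, and let d(x) be the
-- degree of x.  Counting the neighbours of its vertices, a triangle xyz satisfies
-- d(x) + d(y) + d(z) ≤ n + 3b.  Hence every triangle has a vertex of degree at most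
-- 3n/8.  Such a vertex contributes ≥ n²/16 to Σ (2d(x) − n)², which is at most nD plus
-- twice the number T of ordered triangles, while it lies in few triangles because b is
-- small; so T ≤ nD/30 and at most 2D/n vertices have degree O(D/n + b).  On the
-- other hand d(x) + d(y) is n − O(D/n + b) for a positive proportion of the edges xy,
-- and then the third vertex of a triangle on xy has degree O(D/n + b).  A vertex of
-- degree d lies in at most bd/2 triangles, so covering these edges by triangles through
-- the 2D/n vertices of degree O(D/n + b) forces n² ≤ O((D/n)(D/n + b)b).

open import Defs
open import Data.Product using (∃-syntax; _×_; _,_; proj₁; proj₂)
open import Function using (_∘_)
open import Relation.Binary using (tri<; tri≈; tri>)
open import Relation.Binary.PropositionalEquality
open import Relation.Nullary using (¬_; Dec; yes; no; _×-dec_; contradiction)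

module Combinatorics where

  open import Data.Empty using (⊥)
  open import Data.Fin as Fin using (Fin; zero; suc)
  import Data.Fin.Properties as Fin
  open import Data.List using (List; []; _∷_; _++_; length; filter; map; tabulate; allFin; cartesianProduct)
  open import Data.List.Extrema.Nat using (xs≤max)
  open import Data.List.Membership.Propositional.Properties
  open import Data.List.Properties
  open import Data.List.Relation.Binary.Subset.Propositional using (_⊆_)
  open import Data.List.Relation.Unary.All as All using ()
  open import Data.List.Relation.Unary.AllPairs using (_∷_)
  open import Data.List.Relation.Unary.Any using (here; there)
  open import Data.List.Relation.Unary.Unique.Propositional using (Unique)
  import Data.List.Relation.Unary.Unique.Propositional.Properties as Unique
  open import Data.Nat
  open import Data.Nat.Properties
  open import Data.Nat.Tactic.RingSolver using (solve-∀)
  open import Data.Sum using (inj₁; inj₂)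
  open import Level using (0ℓ)
  open import Relation.Unary using (Pred; Decidable)
  open import Algebra.Properties.Semiring.Sum +-*-semiring
    using (sum; sum-syntax; sum-cong-≗; ∑-comm; ∑-distrib-+; *-distribˡ-sum; *-distribʳ-sum)

  -- Polynomial inequalities are read off from identities: A ≤ B is a nonnegative
  -- combination of known inequalities and s the slack, so that no subtraction occurs.
  certify : ∀ {A B P Q} s → A ≤ B → P + B + s ≡ Q + A → P ≤ Q
  certify {A} {B} {P} {Q} s A≤B eq = +-cancelʳ-≤ B P Q (begin
    P + B      ≤⟨ m≤m+n (P + B) s ⟩
    P + B + s  ≡⟨ eq ⟩
    Q + A      ≤⟨ +-monoʳ-≤ Q A≤B ⟩
    Q + B      ∎)
    where open ≤-Reasoning

  -- Inequalities between squares of natural numbers.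

  2mn≤m²+n² : ∀ m n → 2 * (m * n) ≤ m * m + n * n
  2mn≤m²+n² m n with ≤-total m n
  ... | inj₁ m≤n with k , refl ← m≤n⇒∃[o]m+o≡n m≤n =
    subst (2 * (m * (m + k)) ≤_) (sym (eq m k)) (m≤m+n _ _)
    where
    eq : ∀ m k → m * m + (m + k) * (m + k) ≡ 2 * (m * (m + k)) + k * k
    eq = solve-∀
  ... | inj₂ n≤m with k , refl ← m≤n⇒∃[o]m+o≡n n≤m =
    subst (2 * ((n + k) * n) ≤_) (sym (eq n k)) (m≤m+n _ _)
    where
    eq : ∀ n k → (n + k) * (n + k) + n * n ≡ 2 * ((n + k) * n) + k * k
    eq = solve-∀

  -- This is (jn)² ≤ (4n - 8d)² with the cross term moved to the left. The witness `k` is 4n - 8d,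
  -- which the hypothesis makes at least jn.
  square-gap : ∀ n d j → 8 * d + j * n ≤ 4 * n →
          j * n * (j * n) + 16 * (4 * (n * d)) ≤ 16 * (4 * (d * d) + n * n)
  square-gap n d j h with k , e ← m≤n⇒∃[o]m+o≡n (m+n≤o⇒m≤o (8 * d) h) = begin
      j * n * (j * n) + 16 * (4 * (n * d)) ≤⟨ +-monoˡ-≤ _ (*-mono-≤ jn≤k jn≤k) ⟩
      k * k + 16 * (4 * (n * d))           ≡⟨ eq₁ k n d ⟩
      k * k + 16 * d * (4 * n)             ≡⟨ cong (λ z → k * k + 16 * d * z) e ⟨
      k * k + 16 * d * (8 * d + k)         ≡⟨ eq₂ k d ⟩
      64 * (d * d) + (8 * d + k) * (8 * d + k) ≡⟨ cong (λ z → 64 * (d * d) + z * z) e ⟩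
      64 * (d * d) + 4 * n * (4 * n)       ≡⟨ eq₃ n d ⟩
      16 * (4 * (d * d) + n * n)           ∎
    where
    open ≤-Reasoning
    jn≤k : j * n ≤ k
    jn≤k = +-cancelˡ-≤ (8 * d) _ _ (subst (8 * d + j * n ≤_) (sym e) h)
    eq₁ : ∀ k n d → k * k + 16 * (4 * (n * d)) ≡ k * k + 16 * d * (4 * n)
    eq₁ = solve-∀
    eq₂ : ∀ k d → k * k + 16 * d * (8 * d + k) ≡ 64 * (d * d) + (8 * d + k) * (8 * d + k)
    eq₂ = solve-∀
    eq₃ : ∀ n d → 64 * (d * d) + 4 * n * (4 * n) ≡ 16 * (4 * (d * d) + n * n)
    eq₃ = solve-∀

  -- Indicators and finite sums.

  private
    variable
      m n : ℕ
      P P′ P″ : Set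
      U U′ : Set

  [_]ᵢ : Dec P → ℕ
  [ yes _ ]ᵢ = 1
  [ no  _ ]ᵢ = 0

  indicator-yes : (P? : Dec P) → P → [ P? ]ᵢ ≡ 1
  indicator-yes (yes _) _ = refl
  indicator-yes (no ¬p) p = contradiction p ¬p

  indicator-≤1 : (P? : Dec P) → [ P? ]ᵢ ≤ 1
  indicator-≤1 (yes _) = ≤-refl
  indicator-≤1 (no _)  = z≤n

  indicator-× : (P? : Dec P) (Q? : Dec P′) → [ P? ×-dec Q? ]ᵢ ≡ [ P? ]ᵢ * [ Q? ]ᵢ
  indicator-× (yes _) (yes _) = refl
  indicator-× (yes _) (no _)  = refl
  indicator-× (no _)  _       = refl

  indicator-⇔ : (P? : Dec P) (Q? : Dec P′) → (P → P′) → (P′ → P) → [ P? ]ᵢ ≡ [ Q? ]ᵢ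
  indicator-⇔ (yes p) Q? f g = sym (indicator-yes Q? (f p))
  indicator-⇔ (no ¬p) (yes q) f g = contradiction (g q) ¬p
  indicator-⇔ (no ¬p) (no _) f g = refl

  ∑-mono : {f g : Fin n → ℕ} → (∀ i → f i ≤ g i) → sum f ≤ sum g
  ∑-mono {zero}  f≤g = z≤n
  ∑-mono {suc n} f≤g = +-mono-≤ (f≤g zero) (∑-mono (λ i → f≤g (suc i)))

  ∑-const : ∀ n c → ∑[ i < n ] c ≡ n * c
  ∑-const zero c = refl
  ∑-const (suc n) c = cong (c +_) (∑-const n c)

  term≤∑ : (f : Fin n → ℕ) → ∀ i → f i ≤ sum f
  term≤∑ f zero = m≤m+n _ _
  term≤∑ f (suc i) = ≤-trans (term≤∑ (λ j → f (suc j)) i) (m≤n+m _ (f zero))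

  ∑∑-cong : {f g : Fin n → Fin n → ℕ} → (∀ i j → f i j ≡ g i j) →
            ∑[ i < n ] sum (f i) ≡ ∑[ i < n ] sum (g i)
  ∑∑-cong f≡g = sum-cong-≗ λ i → sum-cong-≗ (f≡g i)

  -- Degrees, codegrees and ordered triangles.

  module Counting {n : ℕ} (G : Graph n) where

    open Graph G

    adj : Fin n → Fin n → ℕ
    adj x y = [ x ~? y ]ᵢ

    adj-sym : ∀ x y → adj x y ≡ adj y x
    adj-sym x y = indicator-⇔ (x ~? y) (y ~? x) sym~ sym~

    degree : Fin n → ℕ
    degree x = ∑[ y < n ] adj x y

    codegree : Fin n → Fin n → ℕ
    codegree x y = ∑[ z < n ] (adj x z * adj y z)

    triangle : Fin n → Fin n → Fin n → ℕ
    triangle x y z = adj x y * (adj x z * adj y z)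

    -- S is twice the number of edges, T six times the number of triangles.
    S T Q : ℕ
    S = ∑[ x < n ] degree x
    Q = ∑[ x < n ] (degree x * degree x)
    T = ∑[ x < n ] ∑[ y < n ] ∑[ z < n ] triangle x y z

    -- A triangle through `x` is counted twice, once for each order of its other two vertices.
    triangles∋ : Fin n → ℕ
    triangles∋ x = ∑[ y < n ] ∑[ z < n ] triangle x y z

    triangle-swap₁₂ : ∀ x y z → triangle x y z ≡ triangle y x z
    triangle-swap₁₂ x y z = cong₂ _*_ (adj-sym x y) (*-comm (adj x z) (adj y z))

    triangle-swap₂₃ : ∀ x y z → triangle x y z ≡ triangle x z y
    triangle-swap₂₃ x y z = trans (eq (adj x y) (adj x z) (adj y z))
      (cong (λ t → adj x z * (adj x y * t)) (adj-sym y z))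
      where
      eq : ∀ a b c → a * (b * c) ≡ b * (a * c)
      eq = solve-∀

    -- A vertex `z` adjacent to both `x` and `y` is counted twice on the left, every other vertex at
    -- most once; pointwise this is p + q ≤ 1 + pq for indicators.
    degree-pair : ∀ x y → degree x + degree y ≤ n + codegree x y
    degree-pair x y = begin
      degree x + degree y
        ≡⟨ ∑-distrib-+ (adj x) (adj y) ⟨
      ∑[ z < n ] (adj x z + adj y z)
        ≤⟨ ∑-mono (λ z → pointwise (x ~? z) (y ~? z)) ⟩
      ∑[ z < n ] (1 + adj x z * adj y z)
        ≡⟨ ∑-distrib-+ {n} (λ _ → 1) _ ⟩
      ∑[ z < n ] 1 + codegree x y
        ≡⟨ cong (_+ codegree x y) (trans (∑-const n 1) (*-identityʳ n)) ⟩
      n + codegree x y ∎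
      where
      open ≤-Reasoning
      pointwise : (P? : Dec P) (Q? : Dec P′) → [ P? ]ᵢ + [ Q? ]ᵢ ≤ 1 + [ P? ]ᵢ * [ Q? ]ᵢ
      pointwise (yes _) (yes _) = ≤-refl
      pointwise (yes _) (no _)  = ≤-refl
      pointwise (no _)  Q?      = indicator-≤1 Q?

    -- Pointwise p + q + r ≤ 1 + pq + pr + qr for indicators: a vertex adjacent to k of the three
    -- contributes k on the left and 1 + k(k - 1)/2 on the right.
    degree-triple : ∀ x y z → degree x + degree y + degree z ≤
                              n + (codegree x y + codegree x z + codegree y z)
    degree-triple x y z = begin
      degree x + degree y + degree z
        ≡⟨ cong (_+ degree z) (∑-distrib-+ (adj x) (adj y)) ⟨
      ∑[ w < n ] (adj x w + adj y w) + degree z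
        ≡⟨ ∑-distrib-+ (λ w → adj x w + adj y w) (adj z) ⟨
      ∑[ w < n ] (adj x w + adj y w + adj z w)
        ≤⟨ ∑-mono (λ w → pointwise (x ~? w) (y ~? w) (z ~? w)) ⟩
      ∑[ w < n ] (1 + (adj x w * adj y w + adj x w * adj z w + adj y w * adj z w))
        ≡⟨ ∑-distrib-+ {n} (λ _ → 1) _ ⟩
      ∑[ w < n ] 1 + ∑[ w < n ] (adj x w * adj y w + adj x w * adj z w + adj y w * adj z w)
        ≡⟨ cong₂ _+_ (trans (∑-const n 1) (*-identityʳ n))
             (trans (∑-distrib-+ (λ w → adj x w * adj y w + adj x w * adj z w) _)
               (cong (_+ codegree y z) (∑-distrib-+ (λ w → adj x w * adj y w) _))) ⟩
      n + (codegree x y + codegree x z + codegree y z) ∎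
      where
      open ≤-Reasoning
      pointwise : (P? : Dec P) (Q? : Dec P′) (R? : Dec P″) →
        [ P? ]ᵢ + [ Q? ]ᵢ + [ R? ]ᵢ ≤ 1 + ([ P? ]ᵢ * [ Q? ]ᵢ + [ P? ]ᵢ * [ R? ]ᵢ + [ Q? ]ᵢ * [ R? ]ᵢ)
      pointwise (yes _) (yes _) (yes _) = s≤s (s≤s (s≤s z≤n))
      pointwise (yes _) (yes _) (no _)  = ≤-refl
      pointwise (yes _) (no _)  (yes _) = ≤-refl
      pointwise (yes _) (no _)  (no _)  = ≤-refl
      pointwise (no _)  (yes _) (yes _) = ≤-refl
      pointwise (no _)  (yes _) (no _)  = ≤-refl
      pointwise (no _)  (no _)  R?      = indicator-≤1 R?

    adj*codegree : ∀ x y → ∑[ z < n ] triangle x y z ≡ adj x y * codegree x y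
    adj*codegree x y = sym (*-distribˡ-sum {n} (adj x y) (λ z → adj x z * adj y z))

    ∑-degree² : ∑[ x < n ] ∑[ y < n ] (adj x y * degree x) ≡ Q
    ∑-degree² = sum-cong-≗ λ x → sym (*-distribʳ-sum (degree x) (adj x))

    ∑-degree²′ : ∑[ x < n ] ∑[ y < n ] (adj x y * degree y) ≡ Q
    ∑-degree²′ = trans (∑-comm λ x y → adj x y * degree y)
      (trans (∑∑-cong λ x y → cong (_* degree x) (adj-sym y x)) ∑-degree²)

    ∑-adj* : ∀ c → ∑[ x < n ] ∑[ y < n ] (adj x y * c) ≡ S * c
    ∑-adj* c = trans (sum-cong-≗ λ x → sym (*-distribʳ-sum c (adj x))) (sym (*-distribʳ-sum c degree))

    ∑∑-distrib-+ : (f g : Fin n → Fin n → ℕ) →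
      ∑[ x < n ] ∑[ y < n ] (f x y + g x y) ≡ ∑[ x < n ] sum (f x) + ∑[ x < n ] sum (g x)
    ∑∑-distrib-+ f g = trans (sum-cong-≗ λ x → ∑-distrib-+ (f x) (g x))
      (∑-distrib-+ (λ x → sum (f x)) (λ x → sum (g x)))

    ∑-degree-pair : ∑[ x < n ] ∑[ y < n ] (adj x y * (degree x + degree y)) ≡ 2 * Q
    ∑-degree-pair = begin
      ∑[ x < n ] ∑[ y < n ] (adj x y * (degree x + degree y))
        ≡⟨ ∑∑-cong (λ x y → *-distribˡ-+ (adj x y) (degree x) (degree y)) ⟩
      ∑[ x < n ] ∑[ y < n ] (adj x y * degree x + adj x y * degree y)
        ≡⟨ ∑∑-distrib-+ (λ x y → adj x y * degree x) (λ x y → adj x y * degree y) ⟩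
      ∑[ x < n ] ∑[ y < n ] (adj x y * degree x) + ∑[ x < n ] ∑[ y < n ] (adj x y * degree y)
        ≡⟨ cong₂ _+_ ∑-degree² ∑-degree²′ ⟩
      Q + Q
        ≡⟨ cong (Q +_) (+-identityʳ Q) ⟨
      2 * Q ∎
      where open ≡-Reasoning

    -- Sum `degree-pair` over all ordered adjacent pairs: the degrees give each d(x)² twice, the
    -- codegrees count ordered triangles.
    ∑-degree²-upper : 2 * Q ≤ S * n + T
    ∑-degree²-upper = begin
      2 * Q
        ≡⟨ ∑-degree-pair ⟨
      ∑[ x < n ] ∑[ y < n ] (adj x y * (degree x + degree y))
        ≤⟨ ∑-mono (λ x → ∑-mono λ y → *-monoʳ-≤ (adj x y) (degree-pair x y)) ⟩
      ∑[ x < n ] ∑[ y < n ] (adj x y * (n + codegree x y))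
        ≡⟨ ∑∑-cong (λ x y → trans (*-distribˡ-+ (adj x y) n (codegree x y))
                              (cong (adj x y * n +_) (sym (adj*codegree x y)))) ⟩
      ∑[ x < n ] ∑[ y < n ] (adj x y * n + ∑[ z < n ] triangle x y z)
        ≡⟨ ∑∑-distrib-+ (λ x y → adj x y * n) (λ x y → sum (triangle x y)) ⟩
      ∑[ x < n ] ∑[ y < n ] (adj x y * n) + T
        ≡⟨ cong (_+ T) (∑-adj* n) ⟩
      S * n + T ∎
      where open ≤-Reasoning

    -- Moving the weighted coordinate to the outermost sum leaves, for each `z`, the triangles
    -- through `z`; the symmetry of `triangle` brings `z` to the front.
    ∑-triangle*third : (w : Fin n → ℕ) →
      ∑[ x < n ] ∑[ y < n ] ∑[ z < n ] (triangle x y z * w z) ≡ ∑[ z < n ] (triangles∋ z * w z)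
    ∑-triangle*third w = begin
      ∑[ x < n ] ∑[ y < n ] ∑[ z < n ] (triangle x y z * w z)
        ≡⟨ sum-cong-≗ (λ x → ∑-comm λ y z → triangle x y z * w z) ⟩
      ∑[ x < n ] ∑[ z < n ] ∑[ y < n ] (triangle x y z * w z)
        ≡⟨ ∑-comm (λ x z → ∑[ y < n ] (triangle x y z * w z)) ⟩
      ∑[ z < n ] ∑[ x < n ] ∑[ y < n ] (triangle x y z * w z)
        ≡⟨ sum-cong-≗ (λ z → ∑∑-cong λ x y → cong (_* w z)
             (trans (triangle-swap₂₃ x y z) (triangle-swap₁₂ x z y))) ⟩
      ∑[ z < n ] ∑[ x < n ] ∑[ y < n ] (triangle z x y * w z)
        ≡⟨ sum-cong-≗ (λ z → trans (sum-cong-≗ λ x → sym (*-distribʳ-sum (w z) (triangle z x)))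
                                   (sym (*-distribʳ-sum (w z) (λ x → sum (triangle z x))))) ⟩
      ∑[ z < n ] (triangles∋ z * w z) ∎
      where open ≡-Reasoning

    ∑-triangle*second : (w : Fin n → ℕ) →
      ∑[ x < n ] ∑[ y < n ] ∑[ z < n ] (triangle x y z * w y) ≡ ∑[ z < n ] (triangles∋ z * w z)
    ∑-triangle*second w = trans
      (sum-cong-≗ λ x → trans (∑-comm λ y z → triangle x y z * w y)
                              (∑∑-cong λ y z → cong (_* w z) (triangle-swap₂₃ x z y)))
      (∑-triangle*third w)

    ∑-triangle*first : (w : Fin n → ℕ) →
      ∑[ x < n ] ∑[ y < n ] ∑[ z < n ] (triangle x y z * w x) ≡ ∑[ z < n ] (triangles∋ z * w z)
    ∑-triangle*first w = trans
      (∑-comm λ x y → ∑[ z < n ] (triangle x y z * w x))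
      (trans (∑∑-cong λ x y → sum-cong-≗ λ z → cong (_* w y) (triangle-swap₁₂ y x z))
             (∑-triangle*second w))

    -- If the weights of the vertices of each triangle add up to at least 1, then T is at most the
    -- total weight over the three positions, and the positions contribute equally.
    T-cover : (w : Fin n → ℕ) → (∀ x y z → triangle x y z ≤ triangle x y z * (w x + w y + w z)) →
              T ≤ 3 * ∑[ z < n ] (triangles∋ z * w z)
    T-cover w cover = begin
      T
        ≤⟨ ∑-mono (λ x → ∑-mono λ y → ∑-mono λ z → cover x y z) ⟩
      ∑[ x < n ] ∑[ y < n ] ∑[ z < n ] (triangle x y z * (w x + w y + w z))
        ≡⟨ ∑∑-cong (λ x y → trans (sum-cong-≗ λ z → distrib (triangle x y z) (w x) (w y) (w z))
             (trans (∑-distrib-+ (λ z → triangle x y z * w x + triangle x y z * w y) _)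
               (cong (_+ ∑[ z < n ] (triangle x y z * w z)) (∑-distrib-+ (λ z → triangle x y z * w x) _)))) ⟩
      ∑[ x < n ] ∑[ y < n ] (A x y + B x y + C x y)
        ≡⟨ trans (∑∑-distrib-+ (λ x y → A x y + B x y) C) (cong (_+ ∑[ x < n ] sum (C x)) (∑∑-distrib-+ A B)) ⟩
      ∑[ x < n ] sum (A x) + ∑[ x < n ] sum (B x) + ∑[ x < n ] sum (C x)
        ≡⟨ cong₂ _+_ (cong₂ _+_ (∑-triangle*first w) (∑-triangle*second w)) (∑-triangle*third w) ⟩
      V + V + V
        ≡⟨ triple V ⟩
      3 * V ∎
      where
      open ≤-Reasoning
      A B C : Fin n → Fin n → ℕ
      A x y = ∑[ z < n ] (triangle x y z * w x)
      B x y = ∑[ z < n ] (triangle x y z * w y)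
      C x y = ∑[ z < n ] (triangle x y z * w z)
      V = ∑[ z < n ] (triangles∋ z * w z)
      distrib : ∀ t a b c → t * (a + b + c) ≡ t * a + t * b + t * c
      distrib = solve-∀
      triple : ∀ v → v + v + v ≡ 3 * v
      triple = solve-∀

    -- Squared degrees and the deficit from the edge density of a balanced bipartite graph.

    module Deficit {D : ℕ} (n² : n * n ≡ D + 2 * S) where

      -- Sum of 16(2d(x) - n)² over all vertices, with the cross term moved to the left: each
      -- summand is nonnegative, and at least (jn)² where `P` holds.
      ∑-degree²-lower : ∀ j {P : Fin n → Set} (P? : ∀ x → Dec (P x)) →
        (∀ x → P x → 8 * degree x + j * n ≤ 4 * n) →
        j * n * (j * n) * ∑[ x < n ] [ P? x ]ᵢ + 16 * (4 * (n * S)) ≤ 16 * (4 * Q + n * (n * n))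
      ∑-degree²-lower j P? low = begin
        κ * ∑[ x < n ] [ P? x ]ᵢ + 16 * (4 * (n * S))
          ≡⟨ cong₂ _+_ (*-distribˡ-sum κ (λ x → [ P? x ]ᵢ))
              (trans (cong (λ t → 16 * (4 * t)) (*-distribˡ-sum n degree))
              (trans (cong (16 *_) (*-distribˡ-sum 4 (λ x → n * degree x)))
                     (*-distribˡ-sum 16 (λ x → 4 * (n * degree x))))) ⟩
        ∑[ x < n ] (κ * [ P? x ]ᵢ) + ∑[ x < n ] (16 * (4 * (n * degree x)))
          ≡⟨ ∑-distrib-+ (λ x → κ * [ P? x ]ᵢ) _ ⟨
        ∑[ x < n ] (κ * [ P? x ]ᵢ + 16 * (4 * (n * degree x)))
          ≤⟨ ∑-mono (λ x → pointwise (degree x) (P? x) (low x)) ⟩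
        ∑[ x < n ] (16 * (4 * (degree x * degree x) + n * n))
          ≡⟨ *-distribˡ-sum 16 (λ x → 4 * (degree x * degree x) + n * n) ⟨
        16 * ∑[ x < n ] (4 * (degree x * degree x) + n * n)
          ≡⟨ cong (16 *_) (∑-distrib-+ (λ x → 4 * (degree x * degree x)) (λ _ → n * n)) ⟩
        16 * (∑[ x < n ] (4 * (degree x * degree x)) + ∑[ x < n ] (n * n))
          ≡⟨ cong (16 *_) (cong₂ _+_ (sym (*-distribˡ-sum 4 (λ x → degree x * degree x)))
                                     (∑-const n (n * n))) ⟩
        16 * (4 * Q + n * (n * n)) ∎
        where
        open ≤-Reasoning
        κ = j * n * (j * n)
        assoc : ∀ n d → 2 * (2 * d * n) ≡ 4 * (n * d)
        assoc = solve-∀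
        square : ∀ n d → 2 * d * (2 * d) + n * n ≡ 4 * (d * d) + n * n
        square = solve-∀
        pointwise : ∀ d (P? : Dec P′) → (P′ → 8 * d + j * n ≤ 4 * n) →
          κ * [ P? ]ᵢ + 16 * (4 * (n * d)) ≤ 16 * (4 * (d * d) + n * n)
        pointwise d (yes p) low′ =
          subst (λ t → t + 16 * (4 * (n * d)) ≤ 16 * (4 * (d * d) + n * n)) (sym (*-identityʳ κ))
            (square-gap n d j (low′ p))
        -- Without `P` only (2d - n)² ≥ 0 is available.
        pointwise d (no _) _ =
          subst (λ t → t + 16 * (4 * (n * d)) ≤ 16 * (4 * (d * d) + n * n)) (sym (*-zeroʳ κ))
            (*-monoʳ-≤ 16 (subst₂ _≤_ (assoc n d) (square n d) (2mn≤m²+n² (2 * d) n)))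

      -- By `∑-degree²-upper` and n² = D + 2S, the sum of (2d(x) - n)² is at most nD + 2T, so few
      -- vertices can be far from degree n/2.
      low-degree-count : ∀ j {P : Fin n → Set} (P? : ∀ x → Dec (P x)) →
        (∀ x → P x → 8 * degree x + j * n ≤ 4 * n) →
        j * n * (j * n) * ∑[ x < n ] [ P? x ]ᵢ ≤ 16 * (n * D + 2 * T)
      low-degree-count j P? low = certify 0
        (+-mono-≤ (∑-degree²-lower j P? low) (*-monoʳ-≤ 32 ∑-degree²-upper))
        (trans (cong (λ t → X + (16 * (4 * Q + n * t) + 32 * (S * n + T)) + 0) n²) (eq X n D S Q T))
        where
        X = j * n * (j * n) * ∑[ x < n ] [ P? x ]ᵢ
        eq : ∀ X n D S Q T →
          X + (16 * (4 * Q + n * (D + 2 * S)) + 32 * (S * n + T)) + 0 ≡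
          16 * (n * D + 2 * T) + (X + 16 * (4 * (n * S)) + 32 * (2 * Q))
        eq = solve-∀

      -- The empty predicate in `∑-degree²-lower` leaves just the nonnegativity of the sum of (2d(x)
      -- - n)², which replaces Cauchy-Schwarz as the lower bound on `Q`.
      ∑-degree²-average : 2 * (n * S) ≤ 4 * Q + n * D
      ∑-degree²-average = *-cancelˡ-≤ 16 (certify 0 (∑-degree²-lower 0 {λ _ → ⊥} (λ _ → no λ ()) (λ _ ()))
        (trans (cong (λ t → 16 * (2 * (n * S)) + 16 * (4 * Q + n * t) + 0) n²) (eq n D S Q)))
        where
        eq : ∀ n D S Q →
          16 * (2 * (n * S)) + 16 * (4 * Q + n * (D + 2 * S)) + 0 ≡
          16 * (4 * Q + n * D) + (0 + 16 * (4 * (n * S)))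
        eq = solve-∀

    -- Graphs with small books in which every edge lies in a triangle.

    module SmallBooks
      {b D : ℕ}
      (n² : n * n ≡ D + 2 * S)
      (book : ∀ x y → x ~ y → codegree x y ≤ b)
      (in-triangle : ∀ x y → x ~ y → ∃[ z ] (x ~ z × y ~ z))
      (b-small : 576 * b ≤ n)
      (D-small : 32 * D ≤ n * n)
      (D-pos : 0 < D)
      where

      open Deficit {D} n²

      triangle-degrees : ∀ {x y z} → x ~ y → x ~ z → y ~ z →
                         degree x + degree y + degree z ≤ n + 3 * b
      triangle-degrees {x} {y} {z} xy xz yz = ≤-trans (degree-triple x y z)
        (+-monoʳ-≤ n (subst (codegree x y + codegree x z + codegree y z ≤_) (eq b)
          (+-mono-≤ (+-mono-≤ (book x y xy) (book x z xz)) (book y z yz))))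
        where
        eq : ∀ b → b + b + b ≡ 3 * b
        eq = solve-∀

      -- Each of the d(x) edges at `x` lies in at most b triangles.
      triangles∋≤ : ∀ x → triangles∋ x ≤ degree x * b
      triangles∋≤ x = begin
        triangles∋ x                       ≡⟨ sum-cong-≗ (adj*codegree x) ⟩
        ∑[ y < n ] (adj x y * codegree x y) ≤⟨ ∑-mono (λ y → pointwise (x ~? y) (book x y)) ⟩
        ∑[ y < n ] (adj x y * b)           ≡⟨ *-distribʳ-sum b (adj x) ⟨
        degree x * b                       ∎
        where
        open ≤-Reasoning
        pointwise : ∀ {c} (P? : Dec P) → (P → c ≤ b) → [ P? ]ᵢ * c ≤ [ P? ]ᵢ * b
        pointwise (yes p) c≤b = *-monoʳ-≤ 1 (c≤b p)
        pointwise (no _)  _   = z≤n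

      ∑-triangles∋ : ∀ k K {P : Fin n → Set} (P? : ∀ x → Dec (P x)) → (∀ x → P x → k * degree x ≤ K) →
        k * ∑[ x < n ] (triangles∋ x * [ P? x ]ᵢ) ≤ K * b * ∑[ x < n ] [ P? x ]ᵢ
      ∑-triangles∋ k K P? low = begin
        k * ∑[ x < n ] (triangles∋ x * [ P? x ]ᵢ)
          ≡⟨ *-distribˡ-sum k (λ x → triangles∋ x * [ P? x ]ᵢ) ⟩
        ∑[ x < n ] (k * (triangles∋ x * [ P? x ]ᵢ))
          ≤⟨ ∑-mono (λ x → pointwise x (P? x) (low x)) ⟩
        ∑[ x < n ] (K * b * [ P? x ]ᵢ)
          ≡⟨ *-distribˡ-sum (K * b) (λ x → [ P? x ]ᵢ) ⟨
        K * b * ∑[ x < n ] [ P? x ]ᵢ ∎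
        where
        open ≤-Reasoning
        pointwise : ∀ x (P? : Dec P) → (P → k * degree x ≤ K) →
                    k * (triangles∋ x * [ P? ]ᵢ) ≤ K * b * [ P? ]ᵢ
        pointwise x (yes p) low′ = begin
          k * (triangles∋ x * 1)  ≡⟨ cong (k *_) (*-identityʳ (triangles∋ x)) ⟩
          k * triangles∋ x        ≤⟨ *-monoʳ-≤ k (triangles∋≤ x) ⟩
          k * (degree x * b)      ≡⟨ *-assoc k (degree x) b ⟨
          k * degree x * b        ≤⟨ *-monoˡ-≤ b (low′ p) ⟩
          K * b                   ≡⟨ *-identityʳ (K * b) ⟨
          K * b * 1               ∎
        pointwise x (no _) _ = subst (_≤ K * b * 0)
          (sym (trans (cong (k *_) (*-zeroʳ (triangles∋ x))) (*-zeroʳ k))) z≤n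

      -- For n = 0 the bound 32D ≤ n² would contradict D > 0. The cancellations of factors of n
      -- below rest on this.
      private instance
        n-nonZero : NonZero n
        n-nonZero = ≢-nonZero λ n≡0 → <⇒≱ D-pos
          (≤-trans (m≤n*m D 32) (subst (λ m → 32 * D ≤ m * m) n≡0 D-small))

      low? : ∀ x → Dec (8 * degree x ≤ 3 * n)
      low? x = 8 * degree x ≤? 3 * n

      -- Three degrees above 3n/8 would add up to more than 9n/8, whereas n + 3b is at most n +
      -- n/192. So the indicators of `low?` are weights as `T-cover` requires.
      triangle-low : ∀ x y z →
        triangle x y z ≤ triangle x y z * ([ low? x ]ᵢ + [ low? y ]ᵢ + [ low? z ]ᵢ)
      triangle-low x y z with x ~? y | x ~? z | y ~? z
      ... | no _ | _ | _ = z≤n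
      ... | yes _ | no _ | _ = z≤n
      ... | yes _ | yes _ | no _ = z≤n
      ... | yes xy | yes xz | yes yz with low? x | low? y | low? z
      ... | yes _ | _ | _ = s≤s z≤n
      ... | no _ | yes _ | _ = s≤s z≤n
      ... | no _ | no _ | yes _ = s≤s z≤n
      ... | no hx | no hy | no hz = contradiction (begin-strict
        3 * n + 3 * n + 3 * n
          <⟨ +-mono-< (+-mono-< (≰⇒> hx) (≰⇒> hy)) (≰⇒> hz) ⟩
        8 * degree x + 8 * degree y + 8 * degree z
          ≡⟨ eq₁ (degree x) (degree y) (degree z) ⟩
        8 * (degree x + degree y + degree z)
          ≤⟨ *-monoʳ-≤ 8 (triangle-degrees xy xz yz) ⟩
        8 * (n + 3 * b)
          ≤⟨ certify (552 * b) b-small (eq₂ n b) ⟩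
        3 * n + 3 * n + 3 * n ∎) (<-irrefl refl)
        where
        open ≤-Reasoning
        eq₁ : ∀ x y z → 8 * x + 8 * y + 8 * z ≡ 8 * (x + y + z)
        eq₁ = solve-∀
        eq₂ : ∀ n b → 8 * (n + 3 * b) + n + 552 * b ≡ 3 * n + 3 * n + 3 * n + 576 * b
        eq₂ = solve-∀

      -- The bound feeds on itself: with ℓ low vertices, T ≤ 3 · (3n/8) · bℓ, and n²ℓ ≤ 16(nD + 2T).
      -- The hypothesis 576b ≤ n makes the resulting coefficient of T on the right small enough to
      -- absorb: 512T ≤ 16(nD + 2T).
      few-triangles : 30 * T ≤ n * D
      few-triangles = *-cancelˡ-≤ 16 (certify 0 T-low (eq (n * D) T))
        where
        ℓ = ∑[ x < n ] [ low? x ]ᵢ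
        V = ∑[ x < n ] (triangles∋ x * [ low? x ]ᵢ)
        open ≤-Reasoning
        eq₁ : ∀ n b ℓ → 1728 * (3 * n * b * ℓ) ≡ 9 * (n * ℓ) * (576 * b)
        eq₁ = solve-∀
        eq₂ : ∀ n ℓ → 9 * (n * ℓ) * n ≡ 9 * (1 * n * (1 * n) * ℓ)
        eq₂ = solve-∀
        eq₃ : ∀ V → 4608 * (3 * V) ≡ 1728 * (8 * V)
        eq₃ = solve-∀
        T-low : 512 * T ≤ 16 * (n * D + 2 * T)
        T-low = *-cancelˡ-≤ 9 (begin
          9 * (512 * T)           ≡⟨ *-assoc 9 512 T ⟨
          4608 * T                ≤⟨ *-monoʳ-≤ 4608 (T-cover (λ x → [ low? x ]ᵢ) triangle-low) ⟩
          4608 * (3 * V)          ≡⟨ eq₃ V ⟩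
          1728 * (8 * V)          ≤⟨ *-monoʳ-≤ 1728 (∑-triangles∋ 8 (3 * n) low? (λ _ h → h)) ⟩
          1728 * (3 * n * b * ℓ)  ≡⟨ eq₁ n b ℓ ⟩
          9 * (n * ℓ) * (576 * b) ≤⟨ *-monoʳ-≤ (9 * (n * ℓ)) b-small ⟩
          9 * (n * ℓ) * n         ≡⟨ eq₂ n ℓ ⟩
          -- The gap is j = 1, since 8d ≤ 3n leaves n below 4n.
          9 * (1 * n * (1 * n) * ℓ) ≤⟨ *-monoʳ-≤ 9 (low-degree-count 1 low? λ x h →
                                        subst (8 * degree x + 1 * n ≤_) (eq₄ n) (+-monoˡ-≤ (1 * n) h)) ⟩
          9 * (16 * (n * D + 2 * T)) ∎)
          where
          eq₄ : ∀ n → 3 * n + 1 * n ≡ 4 * n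
          eq₄ = solve-∀
        eq : ∀ X T → 16 * (30 * T) + 16 * (X + 2 * T) + 0 ≡ 16 * X + 512 * T
        eq = solve-∀

      -- If n(n + b − d(x) − d(y)) < M (defined below), then K bounds n d(z) for every
      -- triangle xyz: K = M + 2nb.
      K : ℕ
      K = 2 * D + 4 * (n * b)

      verylow? : ∀ x → Dec (n * degree x ≤ K)
      verylow? x = n * degree x ≤? K

      #verylow : ℕ
      #verylow = ∑[ x < n ] [ verylow? x ]ᵢ

      -- The claim is d ≤ n/8 in the form asked for by `low-degree-count` with j = 3. It holds
      -- because K = 2D + 4nb is at most n²/16 + n²/144, below n²/8.
      verylow⇒low : ∀ x → n * degree x ≤ K → 8 * degree x + 3 * n ≤ 4 * n
      verylow⇒low x nd≤K = *-cancelˡ-≤ (18 * n) {{m*n≢0 18 n}} (certify (8 * (n * n))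
        (+-mono-≤ (+-mono-≤ (*-monoʳ-≤ 144 nd≤K) (*-monoʳ-≤ 9 D-small)) (*-monoʳ-≤ n b-small))
        (eq n (degree x) D b))
        where
        eq : ∀ n d D b → 18 * n * (8 * d + 3 * n) +
               (144 * (2 * D + 4 * (n * b)) + 9 * (n * n) + n * n) + 8 * (n * n) ≡
             18 * n * (4 * n) + (144 * (n * d) + 9 * (32 * D) + n * (576 * b))
        eq = solve-∀

      -- `low-degree-count` gives 9n² times the count ≤ 16(nD + 2T), and `few-triangles` gives 2T ≤
      -- nD/15. Hence the count is at most (256/135)D/n; the factor 135n clears denominators.
      few-verylow : n * #verylow ≤ 2 * D
      few-verylow = *-cancelˡ-≤ (135 * n) {{m*n≢0 135 n}} (certify (14 * (n * D))
        (+-mono-≤ (*-monoʳ-≤ 15 (low-degree-count 3 verylow? verylow⇒low)) (*-monoʳ-≤ 16 few-triangles))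
        (eq n #verylow D T))
        where
        eq : ∀ n h D T → 135 * n * (n * h) +
               (15 * (16 * (n * D + 2 * T)) + 16 * (n * D)) + 14 * (n * D) ≡
             135 * n * (2 * D) + (15 * (3 * n * (3 * n) * h) + 16 * (30 * T))
        eq = solve-∀

      -- By `∑-triangle*third` this is the number of ordered triangles with a very low third vertex,
      -- the form in which it arises in `∑-deficient`.
      T-verylow : ℕ
      T-verylow = ∑[ x < n ] (triangles∋ x * [ verylow? x ]ᵢ)

      -- The average of n(n + b − d(x) − d(y)) over the edges xy is at most 2M/3, so by
      -- Markov's inequality it is below M for at least a third of the edges.
      M : ℕ
      M = 2 * (D + n * b)

      -- Markov's inequality for a single edge, in linear form: n(n + b - d(x) - d(y)) is
      -- nonnegative, and is at least M unless some triangle on xy has a very low third vertex.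
      few-neighbours-or-verylow : ∀ x y → x ~ y →
        M + n * (degree x + degree y) ≤
        n * (n + b) + M * ∑[ z < n ] (triangle x y z * [ verylow? z ]ᵢ)
      few-neighbours-or-verylow x y xy with z , xz , yz ← in-triangle x y xy with n * degree z ≤? K
      -- The triangle xyz makes the last sum at least 1, which pays for M; the rest is d(x) + d(y) ≤
      -- n + b.
      ... | yes low = begin
        M + n * (degree x + degree y)  ≤⟨ +-mono-≤ (m≤m*n M 1) (*-monoʳ-≤ n
                                            (≤-trans (degree-pair x y) (+-monoʳ-≤ n (book x y xy)))) ⟩
        M * 1 + n * (n + b)            ≤⟨ +-monoˡ-≤ (n * (n + b)) (*-monoʳ-≤ M witness) ⟩
        M * H + n * (n + b)            ≡⟨ +-comm (M * H) (n * (n + b)) ⟩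
        n * (n + b) + M * H            ∎
        where
        open ≤-Reasoning
        H = ∑[ z < n ] (triangle x y z * [ verylow? z ]ᵢ)
        witness : 1 ≤ H
        witness = subst (_≤ H)
          (cong₂ _*_ (cong₂ _*_ (indicator-yes (x ~? y) xy)
                       (cong₂ _*_ (indicator-yes (x ~? z) xz) (indicator-yes (y ~? z) yz)))
                     (indicator-yes (verylow? z) low))
          (term≤∑ (λ z → triangle x y z * [ verylow? z ]ᵢ) z)
      -- Here n d(z) > K = M + 2nb, so the bound n + 3b on the three degrees leaves at most n(n + b)
      -- - M for n(d(x) + d(y)).
      ... | no high = ≤-trans (certify 0
        (+-mono-≤ (*-monoʳ-≤ n (triangle-degrees xy xz yz)) (<⇒≤ (≰⇒> high)))
        (eq n b D (degree x) (degree y) (degree z))) (m≤m+n (n * (n + b)) _)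
        where
        eq : ∀ n b D x y z →
          2 * (D + n * b) + n * (x + y) + (n * (n + 3 * b) + n * z) + 0 ≡
          n * (n + b) + (n * (x + y + z) + (2 * D + 4 * (n * b)))
        eq = solve-∀

      -- Multiplying by the indicator of adjacency lets the edgewise bound be summed over all pairs;
      -- on a non-edge the left side is 0.
      deficient : ∀ x y →
        adj x y * M + n * (adj x y * (degree x + degree y)) ≤
        adj x y * (n * (n + b)) + M * ∑[ z < n ] (triangle x y z * [ verylow? z ]ᵢ)
      deficient x y = guard (x ~? y) (few-neighbours-or-verylow x y)
        where
        guard : ∀ {A W B C} (P? : Dec P) → (P → A + n * W ≤ B + C) →
                [ P? ]ᵢ * A + n * ([ P? ]ᵢ * W) ≤ [ P? ]ᵢ * B + C
        guard {A = A} {W} {B} {C} (yes p) f = subst₂ _≤_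
          (cong₂ (λ s t → s + n * t) (sym (*-identityˡ A)) (sym (*-identityˡ W)))
          (cong (_+ C) (sym (*-identityˡ B)))
          (f p)
        guard {C = C} (no _) _ = subst (_≤ C) (sym (*-zeroʳ n)) z≤n

      ∑-deficient : S * M + n * (2 * Q) ≤ S * (n * (n + b)) + M * T-verylow
      ∑-deficient = begin
        S * M + n * (2 * Q)
          ≡⟨ cong₂ _+_ (∑-adj* M) (trans (sum-cong-≗ λ x → sym (*-distribˡ-sum n (λ y → W x y)))
               (trans (sym (*-distribˡ-sum n (λ x → sum (W x)))) (cong (n *_) ∑-degree-pair))) ⟨
        ∑[ x < n ] ∑[ y < n ] (adj x y * M) + ∑[ x < n ] ∑[ y < n ] (n * W x y)
          ≡⟨ ∑∑-distrib-+ (λ x y → adj x y * M) (λ x y → n * W x y) ⟨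
        ∑[ x < n ] ∑[ y < n ] (adj x y * M + n * W x y)
          ≤⟨ ∑-mono (λ x → ∑-mono λ y → deficient x y) ⟩
        ∑[ x < n ] ∑[ y < n ] (adj x y * (n * (n + b)) + M * H x y)
          ≡⟨ ∑∑-distrib-+ (λ x y → adj x y * (n * (n + b))) (λ x y → M * H x y) ⟩
        ∑[ x < n ] ∑[ y < n ] (adj x y * (n * (n + b))) + ∑[ x < n ] ∑[ y < n ] (M * H x y)
          ≡⟨ cong₂ _+_ (∑-adj* (n * (n + b))) (trans (sum-cong-≗ λ x → sym (*-distribˡ-sum M (H x)))
               (trans (sym (*-distribˡ-sum M (λ x → sum (H x))))
                 (cong (M *_) (∑-triangle*third (λ z → [ verylow? z ]ᵢ))))) ⟩
        S * (n * (n + b)) + M * T-verylow ∎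
        where
        open ≤-Reasoning
        W H : Fin n → Fin n → ℕ
        W x y = adj x y * (degree x + degree y)
        H x y = ∑[ z < n ] (triangle x y z * [ verylow? z ]ᵢ)

      -- Since 8S = 4n² - 4D and 4D ≤ n²/8.
      dense : 3 * (n * n) ≤ 8 * S
      dense = certify (28 * D) D-small (trans (cong (λ t → 3 * t + t + 28 * D) n²)
        (eq D S))
        where
        eq : ∀ D S → 3 * (D + 2 * S) + (D + 2 * S) + 28 * D ≡ 8 * S + 32 * D
        eq = solve-∀

      -- With G for `T-verylow`, adding the three weighted inequalities eliminates Q and n²D and
      -- leaves 4SD + 6nbS ≤ 12(D + nb)G. Dropping 2nbS allows division by 4(D + nb), which is
      -- positive because D is.
      many-verylow-triangles : S ≤ 3 * T-verylow
      many-verylow-triangles = *-cancelˡ-≤ (4 * (D + n * b))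
        {{>-nonZero (*-monoʳ-< 4 (≤-trans D-pos (m≤m+n D (n * b))))}}
        (certify (2 * (n * b * S))
          (+-mono-≤ (*-monoʳ-≤ 6 ∑-deficient) (+-mono-≤ (*-monoʳ-≤ (3 * n) ∑-degree²-average) (*-monoʳ-≤ D dense)))
          (eq n D b S Q T-verylow))
        where
        eq : ∀ n D b S Q G →
          4 * (D + n * b) * S +
            (6 * (S * (n * (n + b)) + 2 * (D + n * b) * G) + (3 * n * (4 * Q + n * D) + D * (8 * S)))
            + 2 * (n * b * S) ≡
          4 * (D + n * b) * (3 * G) +
            (6 * (S * (2 * (D + n * b)) + n * (2 * Q)) + (3 * n * (2 * (n * S)) + D * (3 * (n * n))))
        eq = solve-∀

      -- Double counting of the triangles at very low vertices: at least S/3, hence of order n², by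
      -- `many-verylow-triangles`, while each of the at most 2D/n such vertices lies in at most Kb/n
      -- ordered ones.
      book-deficit : n * n * (n * n) ≤ 32 * (D * b * (D + 2 * (n * b)))
      book-deficit = *-cancelˡ-≤ 3 (begin
        3 * (n * n * (n * n))          ≡⟨ eq₁ (n * n) ⟩
        n * n * (3 * (n * n))          ≤⟨ *-monoʳ-≤ (n * n) dense ⟩
        n * n * (8 * S)                ≤⟨ *-monoʳ-≤ (n * n) (*-monoʳ-≤ 8 many-verylow-triangles) ⟩
        n * n * (8 * (3 * T-verylow))  ≡⟨ eq₂ n T-verylow ⟩
        24 * n * (n * T-verylow)       ≤⟨ *-monoʳ-≤ (24 * n) (∑-triangles∋ n K verylow? (λ _ low → low)) ⟩
        24 * n * (K * b * #verylow)    ≡⟨ eq₃ n K b #verylow ⟩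
        24 * (K * b) * (n * #verylow)  ≤⟨ *-monoʳ-≤ (24 * (K * b)) few-verylow ⟩
        24 * (K * b) * (2 * D)         ≡⟨ eq₄ n D b ⟩
        3 * (32 * (D * b * (D + 2 * (n * b)))) ∎)
        where
        open ≤-Reasoning
        eq₁ : ∀ m → 3 * (m * m) ≡ m * (3 * m)
        eq₁ = solve-∀
        eq₂ : ∀ n G → n * n * (8 * (3 * G)) ≡ 24 * n * (n * G)
        eq₂ = solve-∀
        eq₃ : ∀ n K b h → 24 * n * (K * b * h) ≡ 24 * (K * b) * (n * h)
        eq₃ = solve-∀
        eq₄ : ∀ n D b → 24 * ((2 * D + 4 * (n * b)) * b) * (2 * D) ≡
                        3 * (32 * (D * b * (D + 2 * (n * b))))
        eq₄ = solve-∀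

  -- Lengths of filtered lists as sums.

  length-filter-tabulate : {P : Pred U 0ℓ} (P? : Decidable P) (f : Fin n → U) →
    length (filter P? (tabulate f)) ≡ ∑[ i < n ] [ P? (f i) ]ᵢ
  length-filter-tabulate {n = zero}  P? f = refl
  length-filter-tabulate {n = suc n} P? f with P? (f zero)
  ... | yes _ = cong suc (length-filter-tabulate P? (f ∘ suc))
  ... | no _  = length-filter-tabulate P? (f ∘ suc)

  length-filter-cartesianProduct : {P : Pred (U × U′) 0ℓ} (P? : Decidable P)
    (f : Fin m → U) (g : Fin n → U′) →
    length (filter P? (cartesianProduct (tabulate f) (tabulate g))) ≡
    ∑[ i < m ] ∑[ j < n ] [ P? (f i , g j) ]ᵢ
  length-filter-cartesianProduct {m = zero} P? f g = refl
  length-filter-cartesianProduct {m = suc m} {n = n} P? f g = begin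
    length (filter P? (row ++ rows))                 ≡⟨ cong length (filter-++ P? row rows) ⟩
    length (filter P? row ++ filter P? rows)         ≡⟨ length-++ (filter P? row) ⟩
    length (filter P? row) + length (filter P? rows)
      ≡⟨ cong₂ _+_ (trans (cong (length ∘ filter P?) (map-tabulate g (f zero ,_)))
                          (length-filter-tabulate P? (λ j → f zero , g j)))
                   (length-filter-cartesianProduct P? (f ∘ suc) g) ⟩
    ∑[ i < suc m ] ∑[ j < n ] [ P? (f i , g j) ]ᵢ    ∎
    where
    open ≡-Reasoning
    row = map (f zero ,_) (tabulate g)
    rows = cartesianProduct (tabulate (f ∘ suc)) (tabulate g)

  Unique-⊆⇒length≤ : {xs ys : List U} → Unique xs → xs ⊆ ys → length xs ≤ length ys
  Unique-⊆⇒length≤ {xs = []} _ _ = z≤n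
  Unique-⊆⇒length≤ {xs = x ∷ xs} (x∉xs ∷ uxs) xs⊆ys
    -- Deleting one occurrence of `x` from the larger list keeps all of `xs` inside it, because `x`
    -- does not recur in `xs`.
    with as , bs , refl ← ∈-∃++ (xs⊆ys (here refl)) = begin
    suc (length xs)         ≤⟨ s≤s (Unique-⊆⇒length≤ uxs xs⊆as++bs) ⟩
    suc (length (as ++ bs)) ≡⟨ length-++-sucʳ as x bs ⟨
    length (as ++ x ∷ bs)   ∎
    where
    open ≤-Reasoning
    xs⊆as++bs : xs ⊆ as ++ bs
    xs⊆as++bs z∈xs with ∈-++⁻ as (xs⊆ys (there z∈xs))
    ... | inj₁ z∈as         = ∈-++⁺ˡ z∈as
    ... | inj₂ (here refl)  = contradiction refl (All.lookup x∉xs z∈xs)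
    ... | inj₂ (there z∈bs) = ∈-++⁺ʳ as z∈bs

  -- Edges, triangles and books as lists.

  module _ {n : ℕ} (G : Graph n) where

    open Graph G
    open Counting G

    -- `edges` stores an edge with its smaller endpoint first, so an adjacent ordered pair matches
    -- exactly one of the two orientations.
    adj-orient : ∀ x y → adj x y ≡ [ isEdge? G (x , y) ]ᵢ + [ isEdge? G (y , x) ]ᵢ
    adj-orient x y with x Fin.<? y | y Fin.<? x
    ... | yes x<y | yes y<x = contradiction y<x (Fin.<-asym x<y)
    ... | yes x<y | no _    with x ~? y
    ...   | yes _ = refl
    ...   | no _  = refl
    adj-orient x y | no _    | yes y<x  = trans (adj-sym x y) (eq (y ~? x))
      where
      eq : (P? : Dec (y ~ x)) → [ P? ]ᵢ ≡ [ yes y<x ×-dec P? ]ᵢ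
      eq (yes _) = refl
      eq (no _) = refl
    adj-orient x y | no x≮y | no y≮x with x ~? y
    ... | no _    = refl
    ... | yes x~y with Fin.<-cmp x y
    ...   | tri< x<y _ _ = contradiction x<y x≮y
    ...   | tri≈ _ x≡y _ = contradiction x~y (irrefl x≡y)
    ...   | tri> _ _ y<x = contradiction y<x y≮x

    S≡2∣E∣ : S ≡ 2 * ∣E∣ G
    S≡2∣E∣ = begin
      S
        ≡⟨ ∑∑-cong adj-orient ⟩
      ∑[ x < n ] ∑[ y < n ] (e x y + e y x)
        ≡⟨ ∑∑-distrib-+ e (λ x y → e y x) ⟩
      ∑[ x < n ] ∑[ y < n ] e x y + ∑[ x < n ] ∑[ y < n ] e y x
        ≡⟨ cong₂ _+_ E (trans (∑-comm (λ x y → e y x)) E) ⟩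
      ∣E∣ G + ∣E∣ G
        ≡⟨ cong (∣E∣ G +_) (+-identityʳ (∣E∣ G)) ⟨
      2 * ∣E∣ G ∎
      where
      open ≡-Reasoning
      e : Fin n → Fin n → ℕ
      e x y = [ isEdge? G (x , y) ]ᵢ
      E : ∑[ x < n ] ∑[ y < n ] e x y ≡ ∣E∣ G
      E = sym (length-filter-cartesianProduct (isEdge? G) (λ x → x) (λ y → y))

    -- Insertion of `z` into a pair already in increasing order, to match the sorted representation
    -- of triangles.
    arrange : (x y z : Fin n) → Triple
    arrange x y z with z Fin.<? x | z Fin.<? y
    ... | yes _ | _     = z , x , y
    ... | no _  | yes _ = x , z , y
    ... | no _  | no _  = x , y , z

    -- If `z` and `w` were inserted at different positions, comparing coordinates would equate one
    -- of them with a vertex it is strictly below.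
    arrange-injective : ∀ x y {z w} → arrange x y z ≡ arrange x y w → z ≡ w
    arrange-injective x y {z} {w} eq
      with z Fin.<? x | z Fin.<? y | w Fin.<? x | w Fin.<? y | eq
    ... | yes _   | _       | yes _   | _       | refl = refl
    ... | no _    | yes _   | no _    | yes _   | refl = refl
    ... | no _    | no _    | no _    | no _    | refl = refl
    ... | yes z<x | _       | no _    | yes _   | refl = contradiction z<x (Fin.<-irrefl refl)
    ... | yes z<x | _       | no _    | no _    | refl = contradiction z<x (Fin.<-irrefl refl)
    ... | no _    | yes _   | yes w<x | _       | refl = contradiction w<x (Fin.<-irrefl refl)
    ... | no _    | no _    | yes w<x | _       | refl = contradiction w<x (Fin.<-irrefl refl)
    ... | no _    | yes z<y | no _    | no _    | refl = contradiction z<y (Fin.<-irrefl refl)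
    ... | no _    | no _    | no _    | yes w<y | refl = contradiction w<y (Fin.<-irrefl refl)

    ≮∧~⇒> : ∀ {x z} → ¬ (z Fin.< x) → x ~ z → x Fin.< z
    ≮∧~⇒> {x} {z} z≮x x~z with Fin.<-cmp x z
    ... | tri< x<z _ _ = x<z
    ... | tri≈ _ x≡z _ = contradiction x~z (irrefl x≡z)
    ... | tri> _ _ z<x = contradiction z<x z≮x

    arrange-triangle : ∀ {x y z} → IsEdge G (x , y) → x ~ z → y ~ z →
                       IsTriangle G (arrange x y z) × (x , y) ⊂ arrange x y z
    arrange-triangle {x} {y} {z} (x<y , x~y) x~z y~z with z Fin.<? x | z Fin.<? y
    ... | yes z<x | _ =
      ((z<x , sym~ x~z) , (x<y , x~y) , (Fin.<-trans z<x x<y , sym~ y~z)) ,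
      there (here refl) , there (there (here refl))
    ... | no z≮x | yes z<y =
      ((≮∧~⇒> z≮x x~z , x~z) , (z<y , sym~ y~z) , (x<y , x~y)) ,
      here refl , there (there (here refl))
    ... | no z≮x | no z≮y =
      ((x<y , x~y) , (≮∧~⇒> z≮y y~z , y~z) , (≮∧~⇒> z≮x x~z , x~z)) ,
      here refl , there (here refl)

    -- `arrange` sends distinct common neighbours to distinct members of `trianglesContaining`,
    -- whose length is one of the numbers that `bk` maximises.
    codegree≤bk-oriented : ∀ {x y} → IsEdge G (x , y) → codegree x y ≤ bk G
    codegree≤bk-oriented {x} {y} xy = begin
      codegree x y
        ≡⟨ trans (length-filter-tabulate common? (λ z → z))
                 (sum-cong-≗ λ z → indicator-× (x ~? z) (y ~? z)) ⟨
      length commons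
        ≡⟨ length-map (arrange x y) commons ⟨
      length (map (arrange x y) commons)
        ≤⟨ Unique-⊆⇒length≤ (Unique.map⁺ (arrange-injective x y) (Unique.filter⁺ common? (Unique.allFin⁺ n)))
             sub ⟩
      length (trianglesContaining G (x , y))
        ≤⟨ All.lookup (xs≤max 0 (map (length ∘ trianglesContaining G) (edges G)))
             (∈-map⁺ (length ∘ trianglesContaining G)
               (∈-filter⁺ (isEdge? G) (∈-cartesianProduct⁺ (∈-allFin x) (∈-allFin y)) xy)) ⟩
      bk G ∎
      where
      open ≤-Reasoning
      common? : Decidable (λ z → x ~ z × y ~ z)
      common? z = x ~? z ×-dec y ~? z
      commons : List (Fin n)
      commons = filter common? (allFin n)
      sub : map (arrange x y) commons ⊆ trianglesContaining G (x , y)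
      sub t∈ with z , z∈ , refl ← ∈-map⁻ (arrange x y) t∈
             with _ , x~z , y~z ← ∈-filter⁻ common? {xs = allFin n} z∈ =
        let tri , xy⊂ = arrange-triangle xy x~z y~z in
        ∈-filter⁺ ((x , y) ⊂?_)
          (∈-filter⁺ (isTriangle? G)
            (∈-cartesianProduct⁺ (∈-allFin _) (∈-cartesianProduct⁺ (∈-allFin _) (∈-allFin _))) tri)
          xy⊂

    edge-orient : (R : Fin n → Fin n → Set) → (∀ {x y} → R x y → R y x) →
      (∀ {x y} → IsEdge G (x , y) → R x y) → ∀ x y → x ~ y → R x y
    edge-orient R R-sym r x y x~y with Fin.<-cmp x y
    ... | tri< x<y _ _ = r (x<y , x~y)
    ... | tri≈ _ x≡y _ = contradiction x~y (irrefl x≡y)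
    ... | tri> _ _ y<x = R-sym (r (y<x , sym~ x~y))

    codegree≤bk : ∀ x y → x ~ y → codegree x y ≤ bk G
    codegree≤bk = edge-orient (λ x y → codegree x y ≤ bk G)
      (λ {x} {y} → subst (_≤ bk G) (sum-cong-≗ λ z → *-comm (adj x z) (adj y z)))
      codegree≤bk-oriented

    common-neighbour : EveryEdgeInTriangle G → ∀ x y → x ~ y → ∃[ z ] (x ~ z × y ~ z)
    common-neighbour every = edge-orient (λ x y → ∃[ z ] (x ~ z × y ~ z))
      (λ (z , xz , yz) → z , yz , xz)
      λ {x} {y} xy → third xy (every (x , y) xy)
      where
      third : ∀ {x y} → IsEdge G (x , y) → ∃[ t ] (IsTriangle G t × (x , y) ⊂ t) →
              ∃[ z ] (x ~ z × y ~ z)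
      -- The endpoints occupy two positions of the sorted triple and the remaining one is the
      -- witness; equal positions would force x = y against x < y.
      third (x<y , _) ((a , b , c) , ((_ , ab) , (_ , bc) , (_ , ac)) , x∈ , y∈) with x∈ | y∈
      ... | here refl                 | here refl                 = contradiction x<y (Fin.<-irrefl refl)
      ... | here refl                 | there (here refl)         = c , ac , bc
      ... | here refl                 | there (there (here refl)) = b , ab , sym~ bc
      ... | there (here refl)         | here refl                 = c , bc , ac
      ... | there (here refl)         | there (here refl)         = contradiction x<y (Fin.<-irrefl refl)
      ... | there (here refl)         | there (there (here refl)) = a , sym~ ab , sym~ ac
      ... | there (there (here refl)) | here refl                 = b , sym~ bc , ab
      ... | there (there (here refl)) | there (here refl)         = a , sym~ ac , sym~ ab
      ... | there (there (here refl)) | there (there (here refl)) = contradiction x<y (Fin.<-irrefl refl)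

    deficit-book-inequality : ∀ {D} → n * n ≡ D + 4 * ∣E∣ G → EveryEdgeInTriangle G →
      576 * bk G ≤ n → 32 * D ≤ n * n → 0 < D →
      n * n * (n * n) ≤ 32 * (D * bk G * (D + 2 * (n * bk G)))
    deficit-book-inequality {D} n² every b-small D-small D-pos = SmallBooks.book-deficit
      (trans n² (cong (D +_) (trans (*-assoc 2 2 (∣E∣ G)) (cong (2 *_) (sym S≡2∣E∣)))))
      codegree≤bk (common-neighbour every) b-small D-small D-pos

module Estimates where

  open Combinatorics using (certify; deficit-book-inequality)
  open import Data.Integer as ℤ using (+_)
  import Data.Integer.Properties as ℤ
  open import Data.Nat as ℕ using (ℕ; suc)
  import Data.Nat.Properties as ℕ
  import Data.Nat.Tactic.RingSolver as ℕSolver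
  open import Data.Rational hiding (NonZero)
  open import Data.Rational.Properties
  open import Data.Rational.Solver using (module +-*-Solver)
  open import Data.Rational.Unnormalised as ℚᵘ using (mkℚᵘ; *≡*)
  import Data.Rational.Unnormalised.Properties as ℚᵘ
  open +-*-Solver

  -- The embedding of natural numbers and fractions in the rationals.

  ι : ℕ → ℚ
  ι k = + k / 1

  -- Fractions in ℚ are reduced to lowest terms, which blocks computation on variables; in the
  -- unnormalised rationals equality is cross multiplication.
  toℚᵘ-/ : ∀ a m .{{_ : ℕ.NonZero m}} → toℚᵘ (+ a / m) ℚᵘ.≃ + a ℚᵘ./ m
  toℚᵘ-/ a (suc m) = toℚᵘ-fromℚᵘ (mkℚᵘ (+ a) m)

  ι-+ : ∀ a b → ι (a ℕ.+ b) ≡ ι a + ι b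
  ι-+ a b = toℚᵘ-injective (begin
    toℚᵘ (ι (a ℕ.+ b))               ≈⟨ toℚᵘ-/ (a ℕ.+ b) 1 ⟩
    mkℚᵘ (+ (a ℕ.+ b)) 0             ≈⟨ *≡* (cong (ℤ._* + 1)
                                        (cong₂ ℤ._+_ (sym (ℤ.*-identityʳ (+ a))) (sym (ℤ.*-identityʳ (+ b))))) ⟩
    mkℚᵘ (+ a) 0 ℚᵘ.+ mkℚᵘ (+ b) 0   ≈⟨ ℚᵘ.+-cong (toℚᵘ-/ a 1) (toℚᵘ-/ b 1) ⟨
    toℚᵘ (ι a) ℚᵘ.+ toℚᵘ (ι b)       ≈⟨ toℚᵘ-homo-+ (ι a) (ι b) ⟨
    toℚᵘ (ι a + ι b)                 ∎)
    where open ℚᵘ.≃-Reasoning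

  ι-* : ∀ a b → ι (a ℕ.* b) ≡ ι a * ι b
  ι-* a b = toℚᵘ-injective (begin
    toℚᵘ (ι (a ℕ.* b))               ≈⟨ toℚᵘ-/ (a ℕ.* b) 1 ⟩
    mkℚᵘ (+ (a ℕ.* b)) 0             ≈⟨ *≡* (cong (ℤ._* + 1) (ℤ.pos-* a b)) ⟩
    mkℚᵘ (+ a) 0 ℚᵘ.* mkℚᵘ (+ b) 0   ≈⟨ ℚᵘ.*-cong (toℚᵘ-/ a 1) (toℚᵘ-/ b 1) ⟨
    toℚᵘ (ι a) ℚᵘ.* toℚᵘ (ι b)       ≈⟨ toℚᵘ-homo-* (ι a) (ι b) ⟨
    toℚᵘ (ι a * ι b)                 ∎)
    where open ℚᵘ.≃-Reasoning

  ι*/ : ∀ a m .{{_ : ℕ.NonZero m}} → ι m * (+ a / m) ≡ ι a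
  ι*/ a m@(suc _) = toℚᵘ-injective (begin
    toℚᵘ (ι m * (+ a / m))           ≈⟨ toℚᵘ-homo-* (ι m) (+ a / m) ⟩
    toℚᵘ (ι m) ℚᵘ.* toℚᵘ (+ a / m)   ≈⟨ ℚᵘ.*-cong (toℚᵘ-/ m 1) (toℚᵘ-/ a m) ⟩
    mkℚᵘ (+ m) 0 ℚᵘ.* (+ a ℚᵘ./ m)   ≈⟨ *≡* (trans (ℤ.*-identityʳ _)
                                        (trans (ℤ.*-comm (+ m) (+ a)) (cong (λ k → + a ℤ.* + k) (sym (ℕ.*-identityˡ m))))) ⟩
    mkℚᵘ (+ a) 0                     ≈⟨ toℚᵘ-/ a 1 ⟨
    toℚᵘ (ι a)                       ∎)
    where open ℚᵘ.≃-Reasoning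

  ι-mono-≤ : ∀ {a b} → a ℕ.≤ b → ι a ≤ ι b
  ι-mono-≤ {a} {b} a≤b = toℚᵘ-cancel-≤ (begin
    toℚᵘ (ι a)   ≃⟨ toℚᵘ-/ a 1 ⟩
    mkℚᵘ (+ a) 0 ≤⟨ ℚᵘ.*≤* (ℤ.*-monoʳ-≤-nonNeg (+ 1) (ℤ.+≤+ a≤b)) ⟩
    mkℚᵘ (+ b) 0 ≃⟨ toℚᵘ-/ b 1 ⟨
    toℚᵘ (ι b)   ∎)
    where open ℚᵘ.≤-Reasoning

  ι-cancel-< : ∀ {a b} → ι a < ι b → a ℕ.< b
  ι-cancel-< ιa<ιb = ℕ.≰⇒> λ b≤a → <-irrefl refl (<-≤-trans ιa<ιb (ι-mono-≤ b≤a))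

  ι-mono-< : ∀ {a b} → a ℕ.< b → ι a < ι b
  ι-mono-< {a} {b} a<b = <-≤-trans (subst (_< ι (suc a)) (+-identityˡ (ι a))
    (subst (0ℚ + ι a <_) (sym (ι-+ 1 a)) (+-monoˡ-< (ι a) (positive⁻¹ 1ℚ)))) (ι-mono-≤ a<b)

  ι-nonNeg : ∀ a → NonNegative (ι a)
  ι-nonNeg a = nonNegative (ι-mono-≤ {0} {a} ℕ.z≤n)

  ι-pos : ∀ a → .{{_ : ℕ.NonZero a}} → Positive (ι a)
  ι-pos a = positive (ι-mono-< {0} {a} (ℕ.>-nonZero⁻¹ a))

  /-nonNeg : ∀ a m .{{_ : ℕ.NonZero m}} → NonNegative (+ a / m)
  /-nonNeg a m = nonNegative (*-cancelˡ-≤-pos (ι m) {{ι-pos m}}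
    (subst₂ _≤_ (sym (*-zeroʳ (ι m))) (sym (ι*/ a m)) (ι-mono-≤ {0} {a} ℕ.z≤n)))

  /-pos : ∀ a m .{{_ : ℕ.NonZero a}} .{{_ : ℕ.NonZero m}} → Positive (+ a / m)
  /-pos a m = positive (*-cancelˡ-<-nonNeg (ι m) {{ι-nonNeg m}}
    (subst₂ _<_ (sym (*-zeroʳ (ι m))) (sym (ι*/ a m)) (positive⁻¹ (ι a) {{ι-pos a}})))

  p≤∣p∣ : ∀ p → p ≤ ∣ p ∣
  p≤∣p∣ (mkℚ (+ _) _ _)      = ≤-refl
  p≤∣p∣ (mkℚ ℤ.-[1+ _ ] _ _) = *≤* ℤ.-≤+

  -- The rational counterpart of `certify`: if Q < P, adding A ≤ B would separate two equal sums.
  certify-≤ : ∀ {A B P Q} → A ≤ B → P + B ≡ Q + A → P ≤ Q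
  certify-≤ {A} {B} {P} {Q} A≤B eq = ≮⇒≥ λ Q<P →
    <-irrefl (sym eq) (+-mono-<-≤ Q<P A≤B)

  certify-< : ∀ {A B P Q} → A < B → P + B ≡ Q + A → P < Q
  certify-< {A} {B} {P} {Q} A<B eq = ≰⇒> λ Q≤P →
    <-irrefl (sym eq) (+-mono-≤-< Q≤P A<B)

  ∣p-q∣<ε⇒p<q+ε : ∀ {p q ε} → ∣ p - q ∣ < ε → p < q + ε
  ∣p-q∣<ε⇒p<q+ε {p} {q} {ε} h = certify-< (≤-<-trans (p≤∣p∣ (p - q)) h)
    (solve 3 (λ p q ε → p :+ ε := q :+ ε :+ (p :- q)) refl p q ε)

  ∣p-q∣<ε⇒q<p+ε : ∀ {p q ε} → ∣ p - q ∣ < ε → q < p + ε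
  ∣p-q∣<ε⇒q<p+ε {p} {q} {ε} h = certify-<
    (≤-<-trans (p≤∣p∣ (- (p - q))) (subst (_< ε) (sym (∣-p∣≡∣p∣ (p - q))) h))
    (solve 3 (λ p q ε → q :+ ε := p :+ ε :+ :- (p :- q)) refl p q ε)

  -- Estimates for one rational approximation t of f(n).

  module _ (n e : ℕ) .{{_ : ℕ.NonZero n}} where

    -- The edge count is below n²/4 - nt + ε, and nt ≥ t > ε because n ≥ 1.
    ∣E∣<n²/4 : ∀ {t ε} → 0ℚ < ε → ε < t → ∣ ι e - (+ (n ℕ.* n) / 4 - ι n * t) ∣ < ε →
      4 ℕ.* e ℕ.< n ℕ.* n
    ∣E∣<n²/4 {t} {ε} 0<ε ε<t close = ι-cancel-< (subst₂ _<_ (sym (ι-* 4 e)) (ι*/ (n ℕ.* n) 4)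
      (*-monoʳ-<-pos (ι 4) E<q₄))
      where
      instance
        t-nonNeg : NonNegative t
        t-nonNeg = nonNegative (<⇒≤ (<-trans 0<ε ε<t))
      ε<Nt : ε < ι n * t
      ε<Nt = <-≤-trans ε<t (subst (_≤ ι n * t) (*-identityˡ t)
        (*-monoʳ-≤-nonNeg t (ι-mono-≤ (ℕ.>-nonZero⁻¹ n))))
      E<q₄ : ι e < (+ (n ℕ.* n) / 4)
      E<q₄ = certify-< (+-mono-< (∣p-q∣<ε⇒p<q+ε {ι e} {+ (n ℕ.* n) / 4 - ι n * t} close) ε<Nt)
        (solve 4 (λ e q y ε → e :+ (q :- y :+ ε :+ y) := q :+ (e :+ ε)) refl (ι e) (+ (n ℕ.* n) / 4) (ι n * t) ε)

    -- Multiplying by 192 turns n²/4 into 48n² and the tolerance 1/192 into the integer 1.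
    deficit-bound : ∀ {t} → ∣ ι e - (+ (n ℕ.* n) / 4 - ι n * t) ∣ < + 1 / 192 →
      ι (48 ℕ.* (n ℕ.* n)) < ι 192 * (ι n * t) + ι (192 ℕ.* e ℕ.+ 1)
    deficit-bound {t} close = subst₂ _<_ lhs rhs (*-monoʳ-<-pos (ι 192) q₄<)
      where
      q₄< : (+ (n ℕ.* n) / 4) < ι e + (+ 1 / 192) + ι n * t
      q₄< = certify-< (∣p-q∣<ε⇒q<p+ε {ι e} {+ (n ℕ.* n) / 4 - ι n * t} close)
        (solve 4 (λ e q y δ → q :+ (e :+ δ) := e :+ δ :+ y :+ (q :- y)) refl (ι e) (+ (n ℕ.* n) / 4) (ι n * t) (+ 1 / 192))
      lhs : ι 192 * (+ (n ℕ.* n) / 4) ≡ ι (48 ℕ.* (n ℕ.* n))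
      lhs = trans (*-assoc (ι 48) (ι 4) (+ (n ℕ.* n) / 4))
        (trans (cong (ι 48 *_) (ι*/ (n ℕ.* n) 4)) (sym (ι-* 48 (n ℕ.* n))))
      rhs : ι 192 * (ι e + (+ 1 / 192) + ι n * t) ≡ ι 192 * (ι n * t) + ι (192 ℕ.* e ℕ.+ 1)
      rhs = trans
        (solve 2 (λ e y → con (ι 192) :* (e :+ con (+ 1 / 192) :+ y) := con (ι 192) :* y :+ (con (ι 192) :* e :+ con (ι 1)))
          refl (ι e) (ι n * t))
        (cong (λ z → ι 192 * (ι n * t) + z) (sym (trans (ι-+ (192 ℕ.* e) 1) (cong (_+ ι 1) (ι-* 192 e)))))

    module _ {D : ℕ} (n² : n ℕ.* n ≡ D ℕ.+ 4 ℕ.* e) where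

      -- From t < 2n/1000 follows 384t ≤ n, as 768 ≤ 1000. Doubling the bound then gives 96D ≤ n² +
      -- 2 ≤ 3n².
      deficit-small : ∀ {t} → t < + n / 1000 + + n / 1000 →
        ι (48 ℕ.* (n ℕ.* n)) < ι 192 * (ι n * t) + ι (192 ℕ.* e ℕ.+ 1) →
        32 ℕ.* D ℕ.≤ n ℕ.* n
      deficit-small {t} t< bound =
        arithmetic n² (ℕ.*-mono-≤ 1≤n 1≤n) (ℕ.<⇒≤ (ι-cancel-< chain))
        where
        arithmetic : ∀ {m} → m ≡ D ℕ.+ 4 ℕ.* e → 1 ℕ.≤ m →
          2 ℕ.* (48 ℕ.* m) ℕ.≤ m ℕ.+ 2 ℕ.* (192 ℕ.* e ℕ.+ 1) → 32 ℕ.* D ℕ.≤ m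
        arithmetic {m} refl 1≤m h = ℕ.*-cancelˡ-≤ 3 (certify 0 (ℕ.+-mono-≤ h (ℕ.*-monoʳ-≤ 2 1≤m)) (eq D e))
          where
          eq : ∀ D e → 3 ℕ.* (32 ℕ.* D) ℕ.+ ((D ℕ.+ 4 ℕ.* e) ℕ.+ 2 ℕ.* (192 ℕ.* e ℕ.+ 1) ℕ.+ 2 ℕ.* (D ℕ.+ 4 ℕ.* e)) ℕ.+ 0 ≡
               3 ℕ.* (D ℕ.+ 4 ℕ.* e) ℕ.+ (2 ℕ.* (48 ℕ.* (D ℕ.+ 4 ℕ.* e)) ℕ.+ 2 ℕ.* 1)
          eq = ℕSolver.solve-∀
        r : ℚ
        r = + n / 1000
        1≤n : 1 ℕ.≤ n
        1≤n = ℕ.>-nonZero⁻¹ n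
        384t≤n : ι 384 * t ≤ ι n
        384t≤n = begin
          ι 384 * t        ≤⟨ *-monoˡ-≤-nonNeg (ι 384) (<⇒≤ t<) ⟩
          ι 384 * (r + r)  ≡⟨ solve 1 (λ r → con (ι 384) :* (r :+ r) := con (ι 768) :* r) refl r ⟩
          ι 768 * r        ≤⟨ *-monoʳ-≤-nonNeg r {{/-nonNeg n 1000}} (ι-mono-≤ (ℕ.m≤m+n 768 232)) ⟩
          ι 1000 * r       ≡⟨ ι*/ n 1000 ⟩
          ι n              ∎
          where open ≤-Reasoning
        chain : ι (2 ℕ.* (48 ℕ.* (n ℕ.* n))) < ι (n ℕ.* n ℕ.+ 2 ℕ.* (192 ℕ.* e ℕ.+ 1))
        chain = begin-strict
          ι (2 ℕ.* (48 ℕ.* (n ℕ.* n)))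
            ≡⟨ ι-* 2 (48 ℕ.* (n ℕ.* n)) ⟩
          ι 2 * ι (48 ℕ.* (n ℕ.* n))
            <⟨ *-monoʳ-<-pos (ι 2) bound ⟩
          ι 2 * (ι 192 * (ι n * t) + C)
            ≡⟨ solve 3 (λ N t c → con (ι 2) :* (con (ι 192) :* (N :* t) :+ c) :=
                                  N :* (con (ι 384) :* t) :+ con (ι 2) :* c) refl (ι n) t C ⟩
          ι n * (ι 384 * t) + ι 2 * C
            ≤⟨ +-monoˡ-≤ (ι 2 * C) (*-monoˡ-≤-nonNeg (ι n) {{ι-nonNeg n}} 384t≤n) ⟩
          ι n * ι n + ι 2 * C
            ≡⟨ cong₂ _+_ (sym (ι-* n n)) (sym (ι-* 2 (192 ℕ.* e ℕ.+ 1))) ⟩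
          ι (n ℕ.* n) + ι (2 ℕ.* (192 ℕ.* e ℕ.+ 1))
            ≡⟨ ι-+ (n ℕ.* n) (2 ℕ.* (192 ℕ.* e ℕ.+ 1)) ⟨
          ι (n ℕ.* n ℕ.+ 2 ℕ.* (192 ℕ.* e ℕ.+ 1)) ∎
          where
          open ≤-Reasoning
          C = ι (192 ℕ.* e ℕ.+ 1)

      -- Exactly, D is 4n f(n). The approximate bound says 48D < 192nt + 1, and since D ≥ 1 the
      -- error fits into 16D, leaving 32D ≤ 192nt.
      deficit≤6nt : ∀ {t} → 0 ℕ.< D →
        ι (48 ℕ.* (n ℕ.* n)) < ι 192 * (ι n * t) + ι (192 ℕ.* e ℕ.+ 1) →
        ι D ≤ ι 6 * (ι n * t)
      deficit≤6nt {t} 0<D bound = *-cancelˡ-≤-pos (ι 32) (certify-≤ (≤-trans lower (<⇒≤ bound))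
        (solve 3 (λ d c y → con (ι 32) :* d :+ (con (ι 192) :* y :+ c) :=
                            con (ι 32) :* (con (ι 6) :* y) :+ (con (ι 32) :* d :+ c)) refl (ι D) C (ι n * t)))
        where
        C : ℚ
        C = ι (192 ℕ.* e ℕ.+ 1)
        eq : ∀ D e → 32 ℕ.* D ℕ.+ (192 ℕ.* e ℕ.+ 1) ℕ.+ D ℕ.+ 15 ℕ.* D ≡
                     48 ℕ.* (D ℕ.+ 4 ℕ.* e) ℕ.+ 1
        eq = ℕSolver.solve-∀
        lower : ι 32 * ι D + C ≤ ι (48 ℕ.* (n ℕ.* n))
        lower = begin
          ι 32 * ι D + C                          ≡⟨ cong (_+ C) (ι-* 32 D) ⟨
          ι (32 ℕ.* D) + C                        ≡⟨ ι-+ (32 ℕ.* D) (192 ℕ.* e ℕ.+ 1) ⟨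
          ι (32 ℕ.* D ℕ.+ (192 ℕ.* e ℕ.+ 1))      ≤⟨ ι-mono-≤ {32 ℕ.* D ℕ.+ (192 ℕ.* e ℕ.+ 1)} (certify (15 ℕ.* D) 0<D (eq D e)) ⟩
          ι (48 ℕ.* (D ℕ.+ 4 ℕ.* e))              ≡⟨ cong (λ m → ι (48 ℕ.* m)) n² ⟨
          ι (48 ℕ.* (n ℕ.* n))                    ∎
          where open ≤-Reasoning

    module _ {b D : ℕ} (core : n ℕ.* n ℕ.* (n ℕ.* n) ℕ.≤ 32 ℕ.* (D ℕ.* b ℕ.* (D ℕ.+ 2 ℕ.* (n ℕ.* b)))) where

      -- Insert D ≤ 6nt and weaken 2nb to 6nb so that 6n factors out: n⁴ ≤ 32 · 36 · n² t(t + b)b.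
      -- The constant is 1152 ≤ 1250.
      product-bound : ∀ {t} → ι D ≤ ι 6 * (ι n * t) → + (n ℕ.* n) / 1250 ≤ t * (t + ι b) * ι b
      product-bound {t} D≤u = *-cancelˡ-≤-pos (ι 1152 * ι (n ℕ.* n))
        {{pos*pos⇒pos (ι 1152) (ι (n ℕ.* n)) {{ι-pos (n ℕ.* n) {{ℕ.m*n≢0 n n}}}}}} (begin
        ι 1152 * ι (n ℕ.* n) * q
          ≤⟨ *-monoʳ-≤-nonNeg q {{/-nonNeg (n ℕ.* n) 1250}}
               (*-monoʳ-≤-nonNeg (ι (n ℕ.* n)) {{ι-nonNeg (n ℕ.* n)}} (ι-mono-≤ (ℕ.m≤m+n 1152 98))) ⟩
        ι 1250 * ι (n ℕ.* n) * q
          ≡⟨ solve 3 (λ c m q → c :* m :* q := m :* (c :* q)) refl (ι 1250) (ι (n ℕ.* n)) q ⟩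
        ι (n ℕ.* n) * (ι 1250 * q)
          ≡⟨ cong (ι (n ℕ.* n) *_) (ι*/ (n ℕ.* n) 1250) ⟩
        ι (n ℕ.* n) * ι (n ℕ.* n)
          ≡⟨ ι-* (n ℕ.* n) (n ℕ.* n) ⟨
        ι (n ℕ.* n ℕ.* (n ℕ.* n))
          ≤⟨ ι-mono-≤ (ℕ.≤-trans core (ℕ.*-monoʳ-≤ 32 (ℕ.*-monoʳ-≤ (D ℕ.* b)
               (ℕ.+-monoʳ-≤ D (ℕ.*-monoˡ-≤ (n ℕ.* b) (ℕ.m≤m+n 2 4)))))) ⟩
        ι (32 ℕ.* (D ℕ.* b ℕ.* (D ℕ.+ 6 ℕ.* (n ℕ.* b))))
          ≡⟨ trans (ι-* 32 (D ℕ.* b ℕ.* (D ℕ.+ 6 ℕ.* (n ℕ.* b)))) (cong (ι 32 *_)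
               (trans (ι-* (D ℕ.* b) (D ℕ.+ 6 ℕ.* (n ℕ.* b))) (cong₂ _*_ (ι-* D b)
               (trans (ι-+ D (6 ℕ.* (n ℕ.* b))) (cong (λ z → ι D + z) (trans (ι-* 6 (n ℕ.* b)) (cong (ι 6 *_) (ι-* n b)))))))) ⟩
        ι 32 * (ι D * B * (ι D + ι 6 * (ι n * B)))
          ≤⟨ *-monoˡ-≤-nonNeg (ι 32) (≤-trans
               (*-monoʳ-≤-nonNeg (ι D + ι 6 * (ι n * B)) (*-monoʳ-≤-nonNeg B D≤u))
               (*-monoˡ-≤-nonNeg (u * B) (+-monoˡ-≤ (ι 6 * (ι n * B)) D≤u))) ⟩
        ι 32 * (u * B * (u + ι 6 * (ι n * B)))
          ≡⟨ solve 3 (λ N t B → con (ι 32) :* (con (ι 6) :* (N :* t) :* B :* (con (ι 6) :* (N :* t) :+ con (ι 6) :* (N :* B)))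
               := con (ι 1152) :* (N :* N) :* (t :* (t :+ B) :* B)) refl (ι n) t B ⟩
        ι 1152 * (ι n * ι n) * (t * (t + B) * B)
          ≡⟨ cong (λ m → ι 1152 * m * (t * (t + B) * B)) (ι-* n n) ⟨
        ι 1152 * ι (n ℕ.* n) * (t * (t + B) * B) ∎)
        where
        open ≤-Reasoning
        B q u : ℚ
        B = ι b
        q = + (n ℕ.* n) / 1250
        u = ι 6 * (ι n * t)
        instance
          B-nonNeg : NonNegative B
          B-nonNeg = ι-nonNeg b
          uB-nonNeg : NonNegative (u * B)
          uB-nonNeg = nonNeg*nonNeg⇒nonNeg u {{nonNegative (≤-trans (nonNegative⁻¹ (ι D) {{ι-nonNeg D}}) D≤u)}} B
          sum-nonNeg : NonNegative (ι D + ι 6 * (ι n * B))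
          sum-nonNeg = nonNeg+nonNeg⇒nonNeg (ι D) {{ι-nonNeg D}} (ι 6 * (ι n * B))
            {{nonNeg*nonNeg⇒nonNeg (ι 6) (ι n * B) {{nonNeg*nonNeg⇒nonNeg (ι n) {{ι-nonNeg n}} B}}}}

  -- Passage from rational approximations to the real number f(n).

  module _ (f : ℝ) {n : ℕ} .{{_ : ℕ.NonZero n}} (G : Graph n)
    (∣E∣≈ : fromℕ (∣E∣ G) ≈ℝ fromℚ (+ (n ℕ.* n) / 4) -ℝ fromℕ n *ℝ f) where

    -- The uniform gap ε witnessing f > 0 serves also as the tolerance for the edge count.
    edges<n²/4 : f >ℝ 0ℝ → 4 ℕ.* ∣E∣ G ℕ.< n ℕ.* n
    edges<n²/4 (ε , 0<ε , M , f>) with L , close ← ∣E∣≈ ε 0<ε =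
      ∣E∣<n²/4 n (∣E∣ G) {seq f (M ℕ.⊔ L)} {ε} 0<ε
        (subst (_< seq f (M ℕ.⊔ L)) (+-identityˡ ε) (f> (M ℕ.⊔ L) (ℕ.m≤m⊔n M L)))
        (close (M ℕ.⊔ L) (ℕ.m≤n⊔m M L))

    eventual-deficit-bound :
      ∃[ L ] (∀ i → L ℕ.≤ i →
        ι (48 ℕ.* (n ℕ.* n)) < ι 192 * (ι n * seq f i) + ι (192 ℕ.* ∣E∣ G ℕ.+ 1))
    eventual-deficit-bound = proj₁ c , λ i L≤i → deficit-bound n (∣E∣ G) {seq f i} (proj₂ c i L≤i)
      where
      c = ∣E∣≈ (+ 1 / 192) (positive⁻¹ (+ 1 / 192))

    module _ {D : ℕ} (n² : n ℕ.* n ≡ D ℕ.+ 4 ℕ.* ∣E∣ G) where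

      32deficit≤n² : f ≤ℝ fromℚ (+ n / 1000) → 32 ℕ.* D ℕ.≤ n ℕ.* n
      32deficit≤n² f≤ = deficit-small n (∣E∣ G) {D} n² {seq f i}
        (proj₂ below i (ℕ.m≤m⊔n (proj₁ below) L))
        (proj₂ eventual-deficit-bound i (ℕ.m≤n⊔m (proj₁ below) L))
        where
        -- The real inequality f ≤ n/1000 holds termwise only up to a tolerance; n/1000 gives the
        -- 2n/1000 that `deficit-small` expects.
        below = f≤ (+ n / 1000) (positive⁻¹ (+ n / 1000) {{/-pos n 1000}})
        L = proj₁ eventual-deficit-bound
        i = proj₁ below ℕ.⊔ L

      -- Past a fixed index the inequality holds exactly for every term, so ε merely makes it
      -- strict.
      eventual-product-bound : 0 ℕ.< D →
        n ℕ.* n ℕ.* (n ℕ.* n) ℕ.≤ 32 ℕ.* (D ℕ.* bk G ℕ.* (D ℕ.+ 2 ℕ.* (n ℕ.* bk G))) →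
        f *ℝ (f +ℝ fromℕ (bk G)) *ℝ fromℕ (bk G) ≥ℝ fromℚ (+ (n ℕ.* n) / 1250)
      eventual-product-bound 0<D core ε 0<ε = proj₁ eventual-deficit-bound , λ i L≤i →
        ≤-<-trans
          (product-bound n (∣E∣ G) {bk G} {D} core {seq f i}
            (deficit≤6nt n (∣E∣ G) {D} n² {seq f i} 0<D (proj₂ eventual-deficit-bound i L≤i)))
          (p<p+ε (seq f i * (seq f i + ι (bk G)) * ι (bk G)))
        where
        p<p+ε : ∀ p → p < p + ε
        p<p+ε p = subst (_< p + ε) (+-identityʳ p) (+-monoʳ-< p 0<ε)

    small-books : f >ℝ 0ℝ → f ≤ℝ fromℚ (+ n / 1000) →
      EveryEdgeInTriangle G → 1000 ℕ.* bk G ℕ.≤ n →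
      f *ℝ (f +ℝ fromℕ (bk G)) *ℝ fromℕ (bk G) ≥ℝ fromℚ (+ (n ℕ.* n) / 1250)
    small-books f>0 f≤ every b-small = eventual-product-bound {D} n² D-pos
      (deficit-book-inequality G {D} n² every
        (ℕ.≤-trans (ℕ.*-monoˡ-≤ (bk G) (ℕ.m≤m+n 576 424)) b-small)
        (32deficit≤n² {D} n² f≤) D-pos)
      where
      D : ℕ
      -- Truncated subtraction is exact here, because 4e < n².
      D = n ℕ.* n ℕ.∸ 4 ℕ.* ∣E∣ G
      4e<n² : 4 ℕ.* ∣E∣ G ℕ.< n ℕ.* n
      4e<n² = edges<n²/4 f>0
      n² : n ℕ.* n ≡ D ℕ.+ 4 ℕ.* ∣E∣ G
      n² = sym (ℕ.m∸n+n≡m (ℕ.<⇒≤ 4e<n²))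
      D-pos : 0 ℕ.< D
      D-pos = ℕ.m<n⇒0<n∸m 4e<n²

  -- The order on the reals asks for a uniform gap with strict inequality left over, hence the
  -- intermediate rational `m` and the gap m - r.
  large-book : ∀ {n b} → n ℕ.< 1000 ℕ.* b → fromℕ b >ℝ fromℚ (+ n / 1000)
  large-book {n} {b} n<1000b = with-gap (<-dense r<b)
    where
    r : ℚ
    r = + n / 1000
    r<b : r < ι b
    r<b = *-cancelˡ-<-nonNeg (ι 1000) (subst₂ _<_ (sym (ι*/ n 1000)) (ι-* 1000 b) (ι-mono-< n<1000b))
    with-gap : ∃[ m ] (r < m × m < ι b) → fromℕ b >ℝ fromℚ r
    with-gap (m , r<m , m<b) = m - r ,
      certify-< r<m (solve 2 (λ m r → con 0ℚ :+ m := m :- r :+ r) refl m r) ,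
      0 , λ _ _ → subst (_< ι b) (solve 2 (λ m r → m := r :+ (m :- r)) refl m r) m<b

open Estimates
open import Data.Integer using (+_)
open import Data.Nat using (ℕ; NonZero; _*_)
open import Data.Nat.Properties using (≤-<-connex)
open import Data.Rational using (_/_)
open import Data.Sum using (_⊎_; inj₁; inj₂; [_,_]′)

theorem1p3 : (f : (m : ℕ) → .{{_ : NonZero m}} → ℝ) →
    (∀ m → .{{_ : NonZero m}} → f m >ℝ 0ℝ) →
    (n : ℕ) → .{{_ : NonZero n}} →
    f n ≤ℝ fromℚ (+ n / 1000) →
    (G : Graph n) →
    fromℕ (∣E∣ G) ≈ℝ fromℚ (+ (n * n) / 4) -ℝ fromℕ n *ℝ f n →
    EveryEdgeInTriangle G →
    fromℕ (bk G) >ℝ fromℚ (+ n / 1000)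
    ⊎ f n *ℝ (f n +ℝ fromℕ (bk G)) *ℝ fromℕ (bk G) ≥ℝ fromℚ (+ (n * n) / 1250)
theorem1p3 f f>0 n f≤ G ∣E∣≈ every =
  [ (λ b-small → inj₂ (small-books (f n) G ∣E∣≈ (f>0 n) f≤ every b-small))
  , (λ b-large → inj₁ (large-book {n} {bk G} b-large))
  ]′ (≤-<-connex (1000 * bk G) n)
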